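{- Let $n>2$ and $2\le k\le n$, and let $\mathcal{H}$ be a $k$-uniform hypergraph with $n$ vertices. Then its Seidel energy satisfies $$\mathcal{E}(\mathcal{S}(\mathcal{H}))\le n\sqrt{n-1}\left(2\binom{n-2}{k-2}-1\right).$$
   Context: A hypergraph $\mathcal{H}=(V,E)$ consists of a finite vertex set $V$ with $|V|=n$ (identified with $\{1,\dots,n\}$) and a set $E\subseteq 2^{V}$ of hyperedges. All hypergraphs are finite and simple: there is no hyperedge of size $1$, and for distinct hyperedges $e,e'$ neither $e\subset e'$ nor $e'\subset e$. $\mathcal{H}$ is $k$-uniform if every hyperedge has exactly $k$ elements. For distinct vertices $i,j$, the co-degree is $c_{ij}=|\{e\in E: i,j\in e\}|$. The Seidel matrix $\mathcal{S}(\mathcal{H})$ is the real symmetric $n\times n$ matrix with $\mathcal{S}(\mathcal{H})_{ii}=0$ and $\mathcal{S}(\mathcal{H})_{ij}=1-2c_{ij}$ for $i\ne j$. If $\rho_1,\dots,\rho_n$ are its eigenvalues (with multiplicity), the Seidel energy is $\mathcal{E}(\mathcal{S}(\mathcal{H}))=\sum_{i=1}^n|\rho_i|$. -}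

module Defs where

open import Algebra.Bundles.Raw using (RawRing)
import Algebra.Definitions.RawMonoid as RawMonoidDefs
open import Data.Bool.Base using (if_then_else_)
open import Data.Fin.Base using (Fin; zero; suc; punchIn; toℕ)
import Data.Fin.Properties as Fin
open import Data.Fin.Subset using (Subset; _⊆_) renaming (∣_∣ to card)
open import Data.Fin.Subset.Properties using (_∈?_)
open import Data.Integer.Base as ℤ using (ℤ; +_)
import Data.Integer.Properties as ℤ
open import Data.List.Base using (List; length; filter)
open import Data.List.Membership.Propositional using (_∈_)
open import Data.List.Relation.Unary.All using (All)
open import Data.List.Relation.Unary.Unique.Propositional using (Unique)
open import Data.Nat.Base as ℕ using (ℕ; zero; suc)
import Data.Nat.Properties as ℕ
open import Data.Nat.Tactic.RingSolver using (solve-∀)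
open import Data.Product.Base using (∃-syntax; _×_; _,_; proj₁; proj₂)
open import Data.Rational.Base as ℚ using (ℚ; mkℚ; 0ℚ; 1ℚ; ½)
import Data.Rational.Properties as ℚ
open import Data.Rational.Solver using (module +-*-Solver)
open import Data.Rational.Unnormalised.Base as ℚᵘ using (mkℚᵘ)
import Data.Rational.Unnormalised.Properties as ℚᵘ
open import Data.Sum.Base using (inj₁; inj₂)
open import Data.Vec.Functional using (Vector)
open import Level using (0ℓ)
open import Relation.Binary.PropositionalEquality
open import Relation.Nullary.Decidable.Core using (does; yes; no; _×-dec_)

-- Real numbers: Cauchy sequences of rationals (each with its modulus of
-- convergence), compared by the setoid equality _≈_.  As _≈_ and _≤_ bound
-- only the tails, the arithmetic operations can be defined termwise.

IsCauchy : (ℕ → ℚ) → Set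
IsCauchy x = ∀ ε → 0ℚ ℚ.< ε →
  ∃[ N ] (∀ m n → N ℕ.≤ m → N ℕ.≤ n → ℚ.∣ x m ℚ.- x n ∣ ℚ.≤ ε)

record ℝ : Set where
  constructor mkℝ
  field
    seq    : ℕ → ℚ
    cauchy : IsCauchy seq

open ℝ public

infix 4 _≈_ _≤_

_≈_ : ℝ → ℝ → Set
x ≈ y = ∀ ε → 0ℚ ℚ.< ε →
  ∃[ N ] (∀ n → N ℕ.≤ n → ℚ.∣ seq x n ℚ.- seq y n ∣ ℚ.≤ ε)

_≤_ : ℝ → ℝ → Set
x ≤ y = ∀ ε → 0ℚ ℚ.< ε →
  ∃[ N ] (∀ n → N ℕ.≤ n → seq x n ℚ.≤ seq y n ℚ.+ ε)

module _ where
  open +-*-Solver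

  ½-pos : ∀ {ε} → 0ℚ ℚ.< ε → 0ℚ ℚ.< ½ ℚ.* ε
  ½-pos 0<ε = ℚ.*-monoʳ-<-pos ½ 0<ε

  ½+½ : ∀ ε → ½ ℚ.* ε ℚ.+ ½ ℚ.* ε ≡ ε
  ½+½ ε = trans (sym (ℚ.*-distribʳ-+ ε ½ ½)) (ℚ.*-identityˡ ε)

  ∣p∣≤ : ∀ {p q} → p ℚ.≤ q → ℚ.- p ℚ.≤ q → ℚ.∣ p ∣ ℚ.≤ q
  ∣p∣≤ {p} p≤q -p≤q with ℚ.∣p∣≡p∨∣p∣≡-p p
  ... | inj₁ eq = subst (ℚ._≤ _) (sym eq) p≤q
  ... | inj₂ eq = subst (ℚ._≤ _) (sym eq) -p≤q

  ∣p-q∣-comm : ∀ p q → ℚ.∣ p ℚ.- q ∣ ≡ ℚ.∣ q ℚ.- p ∣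
  ∣p-q∣-comm p q = trans (sym (ℚ.∣-p∣≡∣p∣ (p ℚ.- q)))
    (cong ℚ.∣_∣ (solve 2 (λ a b → :- (a :- b) := b :- a) refl p q))

  ∣p∣-∣q∣≤ : ∀ p q → ℚ.∣ p ∣ ℚ.- ℚ.∣ q ∣ ℚ.≤ ℚ.∣ p ℚ.- q ∣
  ∣p∣-∣q∣≤ p q = begin
    ℚ.∣ p ∣ ℚ.- ℚ.∣ q ∣
      ≡⟨ cong (λ r → ℚ.∣ r ∣ ℚ.- ℚ.∣ q ∣)
              (solve 2 (λ a b → a := (a :- b) :+ b) refl p q) ⟩
    ℚ.∣ (p ℚ.- q) ℚ.+ q ∣ ℚ.- ℚ.∣ q ∣
      ≤⟨ ℚ.+-monoˡ-≤ (ℚ.- ℚ.∣ q ∣) (ℚ.∣p+q∣≤∣p∣+∣q∣ (p ℚ.- q) q) ⟩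
    (ℚ.∣ p ℚ.- q ∣ ℚ.+ ℚ.∣ q ∣) ℚ.- ℚ.∣ q ∣
      ≡⟨ solve 2 (λ a b → (a :+ b) :- b := a) refl ℚ.∣ p ℚ.- q ∣ ℚ.∣ q ∣ ⟩
    ℚ.∣ p ℚ.- q ∣ ∎
    where open ℚ.≤-Reasoning

  ∣∣p∣-∣q∣∣≤∣p-q∣ : ∀ p q → ℚ.∣ ℚ.∣ p ∣ ℚ.- ℚ.∣ q ∣ ∣ ℚ.≤ ℚ.∣ p ℚ.- q ∣
  ∣∣p∣-∣q∣∣≤∣p-q∣ p q = ∣p∣≤ (∣p∣-∣q∣≤ p q) (begin
    ℚ.- (ℚ.∣ p ∣ ℚ.- ℚ.∣ q ∣)
      ≡⟨ solve 2 (λ a b → :- (a :- b) := b :- a) refl ℚ.∣ p ∣ ℚ.∣ q ∣ ⟩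
    ℚ.∣ q ∣ ℚ.- ℚ.∣ p ∣  ≤⟨ ∣p∣-∣q∣≤ q p ⟩
    ℚ.∣ q ℚ.- p ∣        ≡⟨ ∣p-q∣-comm q p ⟩
    ℚ.∣ p ℚ.- q ∣        ∎)
    where open ℚ.≤-Reasoning

  const-cauchy : ∀ q → IsCauchy (λ _ → q)
  const-cauchy q ε 0<ε = 0 , λ _ _ _ _ →
    subst (ℚ._≤ ε) (sym (cong ℚ.∣_∣ (ℚ.+-inverseʳ q))) (ℚ.<⇒≤ 0<ε)

  +-cauchy : ∀ {x y} → IsCauchy x → IsCauchy y → IsCauchy (λ n → x n ℚ.+ y n)
  +-cauchy {x} {y} cx cy ε 0<ε
    with cx (½ ℚ.* ε) (½-pos 0<ε) | cy (½ ℚ.* ε) (½-pos 0<ε)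
  ... | N , px | M , py = N ℕ.⊔ M , λ m n N≤m N≤n → begin
    ℚ.∣ (x m ℚ.+ y m) ℚ.- (x n ℚ.+ y n) ∣
      ≡⟨ cong ℚ.∣_∣ (solve 4 (λ a b c d → (a :+ b) :- (c :+ d) := (a :- c) :+ (b :- d))
                           refl (x m) (y m) (x n) (y n)) ⟩
    ℚ.∣ (x m ℚ.- x n) ℚ.+ (y m ℚ.- y n) ∣
      ≤⟨ ℚ.∣p+q∣≤∣p∣+∣q∣ (x m ℚ.- x n) (y m ℚ.- y n) ⟩
    ℚ.∣ x m ℚ.- x n ∣ ℚ.+ ℚ.∣ y m ℚ.- y n ∣
      ≤⟨ ℚ.+-mono-≤ (px m n (ℕ.m⊔n≤o⇒m≤o N M N≤m) (ℕ.m⊔n≤o⇒m≤o N M N≤n))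
                    (py m n (ℕ.m⊔n≤o⇒n≤o N M N≤m) (ℕ.m⊔n≤o⇒n≤o N M N≤n)) ⟩
    ½ ℚ.* ε ℚ.+ ½ ℚ.* ε  ≡⟨ ½+½ ε ⟩
    ε                    ∎
    where open ℚ.≤-Reasoning

  neg-cauchy : ∀ {x} → IsCauchy x → IsCauchy (λ n → ℚ.- x n)
  neg-cauchy {x} cx ε 0<ε with cx ε 0<ε
  ... | N , px = N , λ m n N≤m N≤n → subst (ℚ._≤ ε)
    (trans (∣p-q∣-comm (x m) (x n))
           (cong ℚ.∣_∣ (solve 2 (λ a b → b :- a := (:- a) :- (:- b)) refl (x m) (x n))))
    (px m n N≤m N≤n)

  abs-cauchy : ∀ {x} → IsCauchy x → IsCauchy (λ n → ℚ.∣ x n ∣)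
  abs-cauchy {x} cx ε 0<ε with cx ε 0<ε
  ... | N , px = N , λ m n N≤m N≤n →
    ℚ.≤-trans (∣∣p∣-∣q∣∣≤∣p-q∣ (x m) (x n)) (px m n N≤m N≤n)

  cauchy-bounded : ∀ {x} → IsCauchy x →
    ∃[ B ] (0ℚ ℚ.< B × ∃[ N ] (∀ n → N ℕ.≤ n → ℚ.∣ x n ∣ ℚ.≤ B))
  cauchy-bounded {x} cx with cx 1ℚ (ℚ.positive⁻¹ 1ℚ)
  ... | N , px = 1ℚ ℚ.+ ℚ.∣ x N ∣
               , ℚ.+-mono-<-≤ (ℚ.positive⁻¹ 1ℚ) (ℚ.0≤∣p∣ (x N))
               , N , λ n N≤n → begin
    ℚ.∣ x n ∣
      ≡⟨ cong ℚ.∣_∣ (solve 2 (λ a b → a := (a :- b) :+ b) refl (x n) (x N)) ⟩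
    ℚ.∣ (x n ℚ.- x N) ℚ.+ x N ∣        ≤⟨ ℚ.∣p+q∣≤∣p∣+∣q∣ (x n ℚ.- x N) (x N) ⟩
    ℚ.∣ x n ℚ.- x N ∣ ℚ.+ ℚ.∣ x N ∣    ≤⟨ ℚ.+-monoˡ-≤ ℚ.∣ x N ∣ (px n N N≤n ℕ.≤-refl) ⟩
    1ℚ ℚ.+ ℚ.∣ x N ∣                   ∎
    where open ℚ.≤-Reasoning

  ∣p*q∣≤ : ∀ {p q a b} → ℚ.∣ p ∣ ℚ.≤ a → ℚ.∣ q ∣ ℚ.≤ b → ℚ.∣ p ℚ.* q ∣ ℚ.≤ a ℚ.* b
  ∣p*q∣≤ {p} {q} {a} {b} p≤a q≤b = begin
    ℚ.∣ p ℚ.* q ∣          ≡⟨ ℚ.∣p*q∣≡∣p∣*∣q∣ p q ⟩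
    ℚ.∣ p ∣ ℚ.* ℚ.∣ q ∣    ≤⟨ ℚ.*-monoˡ-≤-nonNeg ℚ.∣ p ∣ {{ℚ.∣-∣-nonNeg p}} q≤b ⟩
    ℚ.∣ p ∣ ℚ.* b          ≤⟨ ℚ.*-monoʳ-≤-nonNeg b
                               {{ℚ.nonNegative (ℚ.≤-trans (ℚ.0≤∣p∣ q) q≤b)}} p≤a ⟩
    a ℚ.* b                ∎
    where open ℚ.≤-Reasoning

  *-diff : ∀ a b c d →
    a ℚ.* b ℚ.- c ℚ.* d ≡ (a ℚ.- c) ℚ.* b ℚ.+ c ℚ.* (b ℚ.- d)
  *-diff = solve 4 (λ a b c d → a :* b :- c :* d := (a :- c) :* b :+ c :* (b :- d)) refl

  *-collect : ∀ d a b → d ℚ.* b ℚ.+ a ℚ.* d ≡ d ℚ.* (a ℚ.+ b)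
  *-collect = solve 3 (λ d a b → d :* b :+ a :* d := d :* (a :+ b)) refl

  quotient : ∀ ε C → 0ℚ ℚ.< ε → 0ℚ ℚ.< C → ∃[ δ ] (0ℚ ℚ.< δ × δ ℚ.* C ≡ ε)
  quotient ε C 0<ε 0<C = ε ℚ.* ℚ.1/ C
    , ℚ.positive⁻¹ _ {{ℚ.pos*pos⇒pos ε (ℚ.1/ C) {{ℚ.1/pos⇒pos C}}}}
    , trans (ℚ.*-assoc ε (ℚ.1/ C) C)
            (trans (cong (ε ℚ.*_) (ℚ.*-inverseˡ C)) (ℚ.*-identityʳ ε))
    where
    instance
      ε-pos : ℚ.Positive ε
      ε-pos = ℚ.positive 0<ε
      C-pos : ℚ.Positive C
      C-pos = ℚ.positive 0<C
      C-nz : ℚ.NonZero C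
      C-nz = ℚ.pos⇒nonZero C

  *-diff-≤ : ∀ a b c d A B δ → ℚ.∣ a ℚ.- c ∣ ℚ.≤ δ → ℚ.∣ b ∣ ℚ.≤ B →
    ℚ.∣ c ∣ ℚ.≤ A → ℚ.∣ b ℚ.- d ∣ ℚ.≤ δ →
    ℚ.∣ a ℚ.* b ℚ.- c ℚ.* d ∣ ℚ.≤ δ ℚ.* (A ℚ.+ B)
  *-diff-≤ a b c d A B δ p q r s = begin
    ℚ.∣ a ℚ.* b ℚ.- c ℚ.* d ∣
      ≡⟨ cong ℚ.∣_∣ (*-diff a b c d) ⟩
    ℚ.∣ (a ℚ.- c) ℚ.* b ℚ.+ c ℚ.* (b ℚ.- d) ∣
      ≤⟨ ℚ.∣p+q∣≤∣p∣+∣q∣ ((a ℚ.- c) ℚ.* b) (c ℚ.* (b ℚ.- d)) ⟩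
    ℚ.∣ (a ℚ.- c) ℚ.* b ∣ ℚ.+ ℚ.∣ c ℚ.* (b ℚ.- d) ∣
      ≤⟨ ℚ.+-mono-≤ (∣p*q∣≤ {a ℚ.- c} {b} {δ} {B} p q) (∣p*q∣≤ {c} {b ℚ.- d} {A} {δ} r s) ⟩
    δ ℚ.* B ℚ.+ A ℚ.* δ  ≡⟨ *-collect δ A B ⟩
    δ ℚ.* (A ℚ.+ B)      ∎
    where open ℚ.≤-Reasoning

  *-cauchy : ∀ {x y} → IsCauchy x → IsCauchy y → IsCauchy (λ n → x n ℚ.* y n)
  *-cauchy {x} {y} cx cy ε 0<ε =
    let A , 0<A , K , bx = cauchy-bounded {x} cx
        B , 0<B , L , by = cauchy-bounded {y} cy
        δ , 0<δ , δC≡ε   = quotient ε (A ℚ.+ B) 0<ε (ℚ.+-mono-< 0<A 0<B)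
        N , px = cx δ 0<δ
        M , py = cy δ 0<δ
    in (K ℕ.⊔ L) ℕ.⊔ (N ℕ.⊔ M) , λ m n h k → let
      KL≤m = ℕ.m⊔n≤o⇒m≤o (K ℕ.⊔ L) (N ℕ.⊔ M) h
      KL≤n = ℕ.m⊔n≤o⇒m≤o (K ℕ.⊔ L) (N ℕ.⊔ M) k
      NM≤m = ℕ.m⊔n≤o⇒n≤o (K ℕ.⊔ L) (N ℕ.⊔ M) h
      NM≤n = ℕ.m⊔n≤o⇒n≤o (K ℕ.⊔ L) (N ℕ.⊔ M) k
    in subst (ℚ.∣ x m ℚ.* y m ℚ.- x n ℚ.* y n ∣ ℚ.≤_) δC≡ε
      (*-diff-≤ (x m) (y m) (x n) (y n) A B δ
        (px m n (ℕ.m⊔n≤o⇒m≤o N M NM≤m) (ℕ.m⊔n≤o⇒m≤o N M NM≤n))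
        (by m (ℕ.m⊔n≤o⇒n≤o K L KL≤m))
        (bx n (ℕ.m⊔n≤o⇒m≤o K L KL≤n))
        (py m n (ℕ.m⊔n≤o⇒n≤o N M NM≤m) (ℕ.m⊔n≤o⇒n≤o N M NM≤n)))

infixl 6 _+_ _-_
infixl 7 _*_
infix  8 -_

-_ ∣_∣ : ℝ → ℝ
- x   = mkℝ (λ n → ℚ.- seq x n) (neg-cauchy {seq x} (cauchy x))
∣ x ∣ = mkℝ (λ n → ℚ.∣ seq x n ∣) (abs-cauchy {seq x} (cauchy x))

_+_ _*_ : ℝ → ℝ → ℝ
x + y = mkℝ (λ n → seq x n ℚ.+ seq y n) (+-cauchy {seq x} {seq y} (cauchy x) (cauchy y))
x * y = mkℝ (λ n → seq x n ℚ.* seq y n) (*-cauchy {seq x} {seq y} (cauchy x) (cauchy y))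

_-_ : ℝ → ℝ → ℝ
x - y = x + (- y)

fromℚ : ℚ → ℝ
fromℚ q = mkℝ (λ _ → q) (const-cauchy q)

fromℤ : ℤ → ℝ
fromℤ z = fromℚ (z ℚ./ 1)

0ℝ 1ℝ : ℝ
0ℝ = fromℚ 0ℚ
1ℝ = fromℚ 1ℚ

ℝ-rawRing : RawRing 0ℓ 0ℓ
ℝ-rawRing = record
  { Carrier = ℝ ; _≈_ = _≈_ ; _+_ = _+_ ; _*_ = _*_ ; -_ = -_ ; 0# = 0ℝ ; 1# = 1ℝ }

-- ⌊√m⌋
isqrt : ℕ → ℕ
isqrt zero    = 0
isqrt (suc m) = next (isqrt m)
  module Isqrt where
  next : ℕ → ℕ
  next r with suc r ℕ.* suc r ℕ.≤? suc m
  ... | yes _ = suc r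
  ... | no  _ = r

isqrt-spec : ∀ m → isqrt m ℕ.* isqrt m ℕ.≤ m × m ℕ.< suc (isqrt m) ℕ.* suc (isqrt m)
isqrt-spec zero = ℕ.z≤n , ℕ.s≤s ℕ.z≤n
isqrt-spec (suc m) = next-spec (isqrt m) (isqrt-spec m)
  where
  open Isqrt m
  next-spec : ∀ r → r ℕ.* r ℕ.≤ m × m ℕ.< suc r ℕ.* suc r →
    next r ℕ.* next r ℕ.≤ suc m × suc m ℕ.< suc (next r) ℕ.* suc (next r)
  next-spec r (lo , hi) with suc r ℕ.* suc r ℕ.≤? suc m
  ... | yes p = p , ℕ.≤-<-trans hi (ℕ.*-mono-< (ℕ.n<1+n (suc r)) (ℕ.n<1+n (suc r)))
  ... | no ¬p = ℕ.≤-trans lo (ℕ.n≤1+n m) , ℕ.≰⇒> ¬p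

-- The j-th term is ⌊√m · (j+1)⌋ / (j+1), within 1/(j+1) of √m.
√-seq : ℕ → ℕ → ℚ
√-seq m j = (+ isqrt (m ℕ.* (suc j ℕ.* suc j))) ℚ./ suc j

m²<n²⇒m<n : ∀ {a b} → a ℕ.* a ℕ.< b ℕ.* b → a ℕ.< b
m²<n²⇒m<n h = ℕ.≰⇒> λ b≤a → ℕ.<⇒≱ h (ℕ.*-mono-≤ b≤a b≤a)

isqrt-ratio : ∀ m J K .{{_ : ℕ.NonZero J}} .{{_ : ℕ.NonZero K}} →
  isqrt (m ℕ.* (J ℕ.* J)) ℕ.* K ℕ.≤ suc (isqrt (m ℕ.* (K ℕ.* K))) ℕ.* J
isqrt-ratio m J K = ℕ.<⇒≤ (m²<n²⇒m<n {p ℕ.* K} {suc q ℕ.* J} (begin-strict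
  (p ℕ.* K) ℕ.* (p ℕ.* K)          ≡⟨ swap p K ⟩
  (p ℕ.* p) ℕ.* (K ℕ.* K)          ≤⟨ ℕ.*-monoˡ-≤ (K ℕ.* K) (proj₁ (isqrt-spec (m ℕ.* (J ℕ.* J)))) ⟩
  (m ℕ.* (J ℕ.* J)) ℕ.* (K ℕ.* K)  ≡⟨ swap′ m J K ⟩
  (m ℕ.* (K ℕ.* K)) ℕ.* (J ℕ.* J)  <⟨ ℕ.*-monoˡ-< (J ℕ.* J) {{ℕ.m*n≢0 J J}}
                                        (proj₂ (isqrt-spec (m ℕ.* (K ℕ.* K)))) ⟩
  (suc q ℕ.* suc q) ℕ.* (J ℕ.* J)  ≡⟨ swap (suc q) J ⟨
  (suc q ℕ.* J) ℕ.* (suc q ℕ.* J)  ∎))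
  where
  open ℕ.≤-Reasoning
  p = isqrt (m ℕ.* (J ℕ.* J))
  q = isqrt (m ℕ.* (K ℕ.* K))
  swap : ∀ a b → (a ℕ.* b) ℕ.* (a ℕ.* b) ≡ (a ℕ.* a) ℕ.* (b ℕ.* b)
  swap = solve-∀
  swap′ : ∀ a b c → (a ℕ.* (b ℕ.* b)) ℕ.* (c ℕ.* c) ≡ (a ℕ.* (c ℕ.* c)) ℕ.* (b ℕ.* b)
  swap′ = solve-∀

/-mono : ∀ a j b k → a ℕ.* suc k ℕ.≤ b ℕ.* suc j → (+ a) ℚ./ suc j ℚ.≤ (+ b) ℚ./ suc k
/-mono a j b k h = ℚ.toℚᵘ-cancel-≤
  (ℚᵘ.≤-respˡ-≃ (ℚᵘ.≃-sym (ℚ.toℚᵘ-fromℚᵘ (mkℚᵘ (+ a) j)))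
  (ℚᵘ.≤-respʳ-≃ (ℚᵘ.≃-sym (ℚ.toℚᵘ-fromℚᵘ (mkℚᵘ (+ b) k)))
  (ℚᵘ.*≤* (subst₂ ℤ._≤_ (ℤ.pos-* a (suc k)) (ℤ.pos-* b (suc j)) (ℤ.+≤+ h)))))

/-suc : ∀ b k → (+ suc b) ℚ./ suc k ≡ (+ 1) ℚ./ suc k ℚ.+ (+ b) ℚ./ suc k
/-suc b k = ℚ.toℚᵘ-injective (begin
  ℚ.toℚᵘ ((+ suc b) ℚ./ suc k)         ≈⟨ ℚ.toℚᵘ-fromℚᵘ (mkℚᵘ (+ suc b) k) ⟩
  mkℚᵘ (+ suc b) k                     ≈⟨ ℚᵘ.*≡* eq ⟩
  mkℚᵘ (+ 1) k ℚᵘ.+ mkℚᵘ (+ b) k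
    ≈⟨ ℚᵘ.+-cong (ℚ.toℚᵘ-fromℚᵘ (mkℚᵘ (+ 1) k)) (ℚ.toℚᵘ-fromℚᵘ (mkℚᵘ (+ b) k)) ⟨
  ℚ.toℚᵘ ((+ 1) ℚ./ suc k) ℚᵘ.+ ℚ.toℚᵘ ((+ b) ℚ./ suc k)
    ≈⟨ ℚ.toℚᵘ-homo-+ ((+ 1) ℚ./ suc k) ((+ b) ℚ./ suc k) ⟨
  ℚ.toℚᵘ ((+ 1) ℚ./ suc k ℚ.+ (+ b) ℚ./ suc k) ∎)
  where
  open ℚᵘ.≃-Reasoning
  nat : ∀ b K → suc b ℕ.* (K ℕ.* K) ≡ (1 ℕ.* K ℕ.+ b ℕ.* K) ℕ.* K
  nat = solve-∀
  K = suc k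
  eq : (+ suc b) ℤ.* (+ (K ℕ.* K)) ≡ ((+ 1) ℤ.* (+ K) ℤ.+ (+ b) ℤ.* (+ K)) ℤ.* (+ K)
  eq = trans (sym (ℤ.pos-* (suc b) (K ℕ.* K))) (trans (cong +_ (nat b K))
       (trans (ℤ.pos-* (1 ℕ.* K ℕ.+ b ℕ.* K) K)
              (cong (ℤ._* (+ K)) (trans (ℤ.pos-+ (1 ℕ.* K) (b ℕ.* K))
                (cong₂ ℤ._+_ (ℤ.pos-* 1 K) (ℤ.pos-* b K))))))

archimedean : ∀ ε → 0ℚ ℚ.< ε → ∃[ N ] (∀ n → N ℕ.≤ n → (+ 1) ℚ./ suc n ℚ.≤ ε)
archimedean ε@(mkℚ (+ suc a) d _) _ = d , λ n d≤n →
  subst ((+ 1) ℚ./ suc n ℚ.≤_) (ℚ.fromℚᵘ-toℚᵘ ε)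
    (/-mono 1 n (suc a) d (ℕ.*-mono-≤ {1} {suc a} (ℕ.s≤s ℕ.z≤n) (ℕ.s≤s d≤n)))
archimedean (mkℚ (+ zero) _ _) (ℚ.*<* (ℤ.+<+ ()))
archimedean (mkℚ ℤ.-[1+ _ ] _ _) (ℚ.*<* ())

√-cauchy : ∀ m → IsCauchy (√-seq m)
√-cauchy m ε 0<ε with archimedean ε 0<ε
... | N , small = N , λ j k N≤j N≤k → ∣p∣≤ (diff≤ j k N≤k)
    (subst (ℚ._≤ ε) (solve 2 (λ a b → b :- a := :- (a :- b)) refl (√-seq m j) (√-seq m k))
      (diff≤ k j N≤j))
  where
  open +-*-Solver
  open ℚ.≤-Reasoning
  diff≤ : ∀ j k → N ℕ.≤ k → √-seq m j ℚ.- √-seq m k ℚ.≤ ε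
  diff≤ j k N≤k = begin
    √-seq m j ℚ.- √-seq m k
      ≤⟨ ℚ.+-monoˡ-≤ (ℚ.- √-seq m k)
           (/-mono (isqrt (m ℕ.* (suc j ℕ.* suc j))) j
                   (suc (isqrt (m ℕ.* (suc k ℕ.* suc k)))) k (isqrt-ratio m (suc j) (suc k))) ⟩
    (+ suc (isqrt (m ℕ.* (suc k ℕ.* suc k)))) ℚ./ suc k ℚ.- √-seq m k
      ≡⟨ cong (ℚ._- √-seq m k) (/-suc (isqrt (m ℕ.* (suc k ℕ.* suc k))) k) ⟩
    ((+ 1) ℚ./ suc k ℚ.+ √-seq m k) ℚ.- √-seq m k
      ≡⟨ solve 2 (λ a b → (a :+ b) :- b := a) refl ((+ 1) ℚ./ suc k) (√-seq m k) ⟩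
    (+ 1) ℚ./ suc k  ≤⟨ small k N≤k ⟩
    ε                ∎

√ : ℕ → ℝ
√ m = mkℝ (√-seq m) (√-cauchy m)

module Linear {c ℓ} (R : RawRing c ℓ) where
  private module R = RawRing R

  open RawMonoidDefs R.+-rawMonoid public using () renaming (sum to ∑)
  open RawMonoidDefs R.*-rawMonoid public using () renaming (sum to ∏)

  Matrix : ℕ → Set c
  Matrix n = Fin n → Fin n → R.Carrier

  sign : ℕ → R.Carrier
  sign zero    = R.1#
  sign (suc j) = R.- sign j

  -- Laplace expansion along the first row.
  det : ∀ {n} → Matrix n → R.Carrier
  det {zero}  A = R.1#
  det {suc n} A = ∑ λ j →
    (sign (toℕ j) R.* A zero j) R.* det (λ i l → A (suc i) (punchIn j l))

  scalar : ∀ {n} → R.Carrier → Matrix n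
  scalar x i j = if does (i Fin.≟ j) then x else R.0#

  charPoly : ∀ {n} → Matrix n → R.Carrier → R.Carrier
  charPoly A x = det λ i j → scalar x i j R.+ R.- A i j

open Linear ℝ-rawRing public

-- ρ lists the eigenvalues of A with (algebraic) multiplicity: the polynomial
-- functions det(xI − A) and ∏ᵢ (x − ρᵢ) on ℝ coincide.  Over ℝ this is the
-- same as equality of the polynomials.
IsSpectrum : ∀ {n} → Matrix n → Vector ℝ n → Set
IsSpectrum A ρ = ∀ x → charPoly A x ≈ ∏ (λ i → x - ρ i)

-- The hyperedge set is a duplicate-free list of subsets of Fin n.
record Hypergraph (n : ℕ) : Set where
  field
    edges       : List (Subset n)
    unique      : Unique edges
    noSingleton : ∀ {e} → e ∈ edges → card e ≢ 1
    antichain   : ∀ {e e′} → e ∈ edges → e′ ∈ edges → e ⊆ e′ → e ≡ e′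

open Hypergraph public

IsUniform : ∀ {n} → ℕ → Hypergraph n → Set
IsUniform k ℋ = All (λ e → card e ≡ k) (edges ℋ)

codegree : ∀ {n} → Hypergraph n → Fin n → Fin n → ℕ
codegree ℋ i j = length (filter (λ e → (i ∈? e) ×-dec (j ∈? e)) (edges ℋ))

seidel : ∀ {n} → Hypergraph n → Matrix n
seidel ℋ i j =
  if does (i Fin.≟ j) then 0ℝ else fromℤ (+ 1 ℤ.- + (2 ℕ.* codegree ℋ i j))

-- The Seidel energy of ℋ, for a list ρ of the eigenvalues of seidel ℋ.
energy : ∀ {n} → Vector ℝ n → ℝ
energy ρ = ∑ λ i → ∣ ρ i ∣

{-# OPTIONS --safe #-}
module Submission where

open import Defs
open import Algebra.Bundles using (CommutativeRing)
open import Algebra.Bundles.Raw using (RawRing)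
open import Data.Bool.Base using (Bool; true; false)
open import Data.Empty using (⊥)
open import Data.Fin.Base using (Fin; zero; suc; punchIn; punchOut; toℕ)
import Data.Fin.Properties as Fin
open import Data.Fin.Subset using (Subset) renaming (∣_∣ to card)
open import Data.Fin.Subset.Properties using (_∈?_)
open import Data.Integer.Base as ℤ using (ℤ; +_)
import Data.Integer.Properties as ℤ
open import Data.List.Base using (List; []; _∷_; length; map; filter)
open import Data.List.Properties using (length-map)
open import Data.List.Relation.Unary.All as All using (All; []; _∷_)
import Data.List.Relation.Unary.All.Properties as All
open import Data.List.Relation.Unary.AllPairs using ([]; _∷_)
open import Data.List.Relation.Unary.Unique.Propositional using (Unique)
import Data.List.Relation.Unary.Unique.Propositional.Properties as Unique
open import Data.Nat.Base as ℕ using (ℕ; zero; suc)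
open import Data.Nat.Combinatorics using (_C_; nCk≡nC[n∸k]; nCn≡1; nCk+nC[k+1]≡[n+1]C[k+1])
import Data.Nat.Properties as ℕ
open import Data.Product.Base using (∃-syntax; _×_; _,_; proj₁; proj₂)
open import Data.Rational.Base as ℚ using (ℚ; 0ℚ; 1ℚ; ½)
import Data.Rational.Properties as ℚ
open import Data.Rational.Solver using (module +-*-Solver)
open import Data.Rational.Unnormalised.Base as ℚᵘ using (mkℚᵘ)
import Data.Rational.Unnormalised.Properties as ℚᵘ
open import Data.Sum.Base using (inj₁; inj₂)
open import Data.Vec.Base using ([]; _∷_; lookup; removeAt; insertAt)
open import Data.Vec.Functional using (Vector; tail)
open import Data.Vec.Properties using ([]=⇒lookup; insertAt-removeAt; removeAt-punchOut)
open import Relation.Binary.PropositionalEquality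
open import Relation.Nullary.Decidable.Core using (yes; no; _×-dec_)
open import Relation.Nullary.Negation.Core using (contradiction)
open import Algebra.Properties.Semiring.Sum
  (CommutativeRing.semiring ℚ.+-*-commutativeRing) using (sum; sum-cong-≗)
open +-*-Solver using (solve; con; _:+_; _:*_; :-_; _:-_; _:=_)

private module Q = Linear ℚ.+-*-rawRing

-- If det(xI − S) = ∏ (x − ρᵢ), comparing the coefficients of xⁿ⁻¹ and xⁿ⁻²
-- gives ∑ ρᵢ² = (tr S)² − 2 e₂(S) = ∑ᵢⱼ Sᵢⱼ Sⱼᵢ ≤ n(n−1)D² with
-- D = 2 C(n−2, k−2) − 1, since a pair of vertices lies in at most
-- C(n−2, k−2) hyperedges; Cauchy–Schwarz then bounds ∑ |ρᵢ| by n √(n−1) D.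
-- As ρ is only known through rational approximations, the m-th terms of all
-- sequences are compared: there the two polynomials agree up to an error that
-- vanishes as m → ∞ for each x, hence so do their coefficients.

-- Polynomials and determinants

-- Polynomials are written leading coefficient first: horner d c is the
-- function x ↦ c₀ xᵈ + c₁ xᵈ⁻¹ + ⋯ + c_d, and shift raises the formal degree.

-- The operations of ℝ act term by term, so taking the m-th term commutes with `det` and `∏` up to
-- `≡`, and all the algebra can take place in ℚ. The entries of S are constant sequences, hence the
-- determinant has the same rational coefficients for every m; only the terms of ρ move. These terms
-- need not be eigenvalues of anything: all that is known is that their elementary symmetric
-- functions approach the right values. The obstacle on the determinant side is that a Laplace
-- cofactor of xI + B is in general not of the form xI + B. The coefficients are therefore defined
-- for det(xU + B) with arbitrary U, and the top three of them are computed by following which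
-- cofactors keep enough of the identity in U: an x-free column costs one degree. On the analytic
-- side ∑ rᵢ² has no square root in ℚ, so ∑ |rᵢ| is compared with a rational R through their
-- squares. The coefficient error then appears under a square, which is why its tolerance is
-- proportional to η² and not to η.

horner : ℕ → (ℕ → ℚ) → ℚ → ℚ
horner zero    c x = c 0
horner (suc d) c x = x ℚ.* horner d c x ℚ.+ c (suc d)

shift : (ℕ → ℚ) → ℕ → ℚ
shift c zero    = 0ℚ
shift c (suc i) = c i

horner-shift : ∀ d c x → horner (suc d) (shift c) x ≡ horner d c x
horner-shift zero    c x = solve 2 (λ x a → x :* con 0ℚ :+ a := a) refl x (c 0)
horner-shift (suc d) c x = cong (λ h → x ℚ.* h ℚ.+ c (suc d)) (horner-shift d c x)

horner-0 : ∀ d x → horner d (λ _ → 0ℚ) x ≡ 0ℚ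
horner-0 zero    x = refl
horner-0 (suc d) x = trans (cong (λ h → x ℚ.* h ℚ.+ 0ℚ) (horner-0 d x))
  (solve 1 (λ x → x :* con 0ℚ :+ con 0ℚ := con 0ℚ) refl x)

horner-+ : ∀ d c e x → horner d (λ i → c i ℚ.+ e i) x ≡ horner d c x ℚ.+ horner d e x
horner-+ zero    c e x = refl
horner-+ (suc d) c e x =
  trans (cong (λ h → x ℚ.* h ℚ.+ (c (suc d) ℚ.+ e (suc d))) (horner-+ d c e x))
    (solve 5 (λ x h k a b → x :* (h :+ k) :+ (a :+ b) := (x :* h :+ a) :+ (x :* k :+ b))
      refl x (horner d c x) (horner d e x) (c (suc d)) (e (suc d)))

horner-* : ∀ d a c x → horner d (λ i → a ℚ.* c i) x ≡ a ℚ.* horner d c x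
horner-* zero    a c x = refl
horner-* (suc d) a c x =
  trans (cong (λ h → x ℚ.* h ℚ.+ a ℚ.* c (suc d)) (horner-* d a c x))
    (solve 4 (λ x a h b → x :* (a :* h) :+ a :* b := a :* (x :* h :+ b))
      refl x a (horner d c x) (c (suc d)))

horner-- : ∀ d c e x → horner d (λ i → c i ℚ.- e i) x ≡ horner d c x ℚ.- horner d e x
horner-- zero    c e x = refl
horner-- (suc d) c e x =
  trans (cong (λ h → x ℚ.* h ℚ.+ (c (suc d) ℚ.- e (suc d))) (horner-- d c e x))
    (solve 5 (λ x h k a b → x :* (h :- k) :+ (a :- b) := (x :* h :+ a) :- (x :* k :+ b))
      refl x (horner d c x) (horner d e x) (c (suc d)) (e (suc d)))

horner-sum : ∀ d {n} (c : Fin n → ℕ → ℚ) x →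
  horner d (λ i → sum (λ j → c j i)) x ≡ sum (λ j → horner d (c j) x)
horner-sum d {zero}  c x = horner-0 d x
horner-sum d {suc n} c x =
  trans (horner-+ d (c zero) (λ i → sum (λ j → c (suc j) i)) x)
        (cong (horner d (c zero) x ℚ.+_) (horner-sum d (λ j → c (suc j)) x))

sum-zero : ∀ {n} (f : Fin n → ℚ) → (∀ j → f j ≡ 0ℚ) → sum f ≡ 0ℚ
sum-zero {zero}  f f≡0 = refl
sum-zero {suc n} f f≡0 =
  cong₂ ℚ._+_ (f≡0 zero) (sum-zero (λ j → f (suc j)) (λ j → f≡0 (suc j)))

-- The top three coefficients of a determinant

minor : ∀ {n} → Q.Matrix (suc n) → Fin (suc n) → Q.Matrix n
minor A j i l = A (suc i) (punchIn j l)

-- The coefficients of det(xU + B).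
detCoeff : ∀ {n} → Q.Matrix n → Q.Matrix n → ℕ → ℚ
detCoeff {zero}  U B zero    = 1ℚ
detCoeff {zero}  U B (suc i) = 0ℚ
-- The formal degree rises from n to n + 1. With indices counted from the top, x times the cofactor
-- keeps its index, while the cofactor itself moves one place down: hence `shift` beside B only.
detCoeff {suc n} U B i       = sum λ j → Q.sign (toℕ j) ℚ.*
  (U zero j ℚ.* detCoeff (minor U j) (minor B j) i
    ℚ.+ B zero j ℚ.* shift (detCoeff (minor U j) (minor B j)) i)

-- In `det-homo` a cofactor of degree n is read at formal degree n + 1; the value of `horner` then
-- involves one more coefficient, which has to be zero.
detCoeff-above : ∀ {n} (U B : Q.Matrix n) i → n ℕ.< i → detCoeff U B i ≡ 0ℚ
detCoeff-above {zero}  U B (suc i) _ = refl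
detCoeff-above {suc n} U B (suc i) (ℕ.s≤s n<i) = sum-zero _ λ j →
  trans (cong₂ (λ p q → Q.sign (toℕ j) ℚ.* (U zero j ℚ.* p ℚ.+ B zero j ℚ.* q))
          (detCoeff-above (minor U j) (minor B j) (suc i) (ℕ.s≤s (ℕ.<⇒≤ n<i)))
          (detCoeff-above (minor U j) (minor B j) i n<i))
    (solve 3 (λ s u b → s :* (u :* con 0ℚ :+ b :* con 0ℚ) := con 0ℚ)
      refl (Q.sign (toℕ j)) (U zero j) (B zero j))

-- The first column of xU + B is free of x, so the degree stays below the size. Under expansion
-- along the top row, every cofactor but the first keeps such a column.
lead-zero-column : ∀ {n} (U B : Q.Matrix (suc n)) → (∀ i → U i zero ≡ 0ℚ) →
  detCoeff U B 0 ≡ 0ℚ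
lead-zero-column {n} U B U0 = sum-zero _ (term n U B U0)
  where
  term : ∀ n (U B : Q.Matrix (suc n)) → (∀ i → U i zero ≡ 0ℚ) → ∀ j →
    Q.sign (toℕ j) ℚ.* (U zero j ℚ.* detCoeff (minor U j) (minor B j) 0
      ℚ.+ B zero j ℚ.* 0ℚ) ≡ 0ℚ
  term n U B U0 zero =
    trans (cong (λ u → 1ℚ ℚ.* (u ℚ.* c ℚ.+ B zero zero ℚ.* 0ℚ)) (U0 zero))
      (solve 2 (λ c b → con 1ℚ :* (con 0ℚ :* c :+ b :* con 0ℚ) := con 0ℚ)
        refl c (B zero zero))
    where c = detCoeff (minor U zero) (minor B zero) 0
  term (suc n) U B U0 (suc l) =
    trans (cong (λ c → s ℚ.* (U zero (suc l) ℚ.* c ℚ.+ B zero (suc l) ℚ.* 0ℚ))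
            (lead-zero-column (minor U (suc l)) (minor B (suc l)) λ i → U0 (suc i)))
      (solve 3 (λ s u b → s :* (u :* con 0ℚ :+ b :* con 0ℚ) := con 0ℚ)
        refl s (U zero (suc l)) (B zero (suc l)))
    where s = Q.sign (suc (toℕ l))

IsIdentity : ∀ {n} → Q.Matrix n → Set
IsIdentity U = ∀ i j → U i j ≡ Q.scalar 1ℚ i j

minor-identity : ∀ {n} (U : Q.Matrix (suc n)) → IsIdentity U → IsIdentity (minor U zero)
minor-identity U U≡I i j = U≡I (suc i) (suc j)

-- Entries of B cannot reach the top degree, and the top row of U is nonzero in column 0 only, so
-- the expansion follows the diagonal.
lead-identity : ∀ {n} (U B : Q.Matrix n) → IsIdentity U → detCoeff U B 0 ≡ 1ℚ
lead-identity {zero}  U B U≡I = refl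
lead-identity {suc n} U B U≡I = trans (cong₂ ℚ._+_
    (trans (cong₂ (λ u c → 1ℚ ℚ.* (u ℚ.* c ℚ.+ B zero zero ℚ.* 0ℚ)) (U≡I zero zero)
             (lead-identity (minor U zero) (minor B zero) (minor-identity U U≡I)))
           (solve 1 (λ b → con 1ℚ :* (con 1ℚ :* con 1ℚ :+ b :* con 0ℚ) := con 1ℚ)
             refl (B zero zero)))
    (sum-zero _ λ l →
      trans (cong (λ u → s l ℚ.* (u ℚ.* c l ℚ.+ B zero (suc l) ℚ.* 0ℚ)) (U≡I zero (suc l)))
        (solve 3 (λ s c b → s :* (con 0ℚ :* c :+ b :* con 0ℚ) := con 0ℚ)
          refl (s l) (c l) (B zero (suc l)))))
  (ℚ.+-identityʳ 1ℚ)
  where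
  s c : Fin n → ℚ
  s l = Q.sign (suc (toℕ l))
  c l = detCoeff (minor U (suc l)) (minor B (suc l)) 0

-- U is the identity with its top row and its column j + 1 deleted.
second-punctured : ∀ {n} (j : Fin (suc n)) (U B : Q.Matrix (suc n)) →
  (∀ i → U i zero ≡ 0ℚ) → (∀ i l → U i (suc l) ≡ Q.scalar 1ℚ i (punchIn j l)) →
  detCoeff U B 1 ≡ Q.sign (toℕ j) ℚ.* B j zero
-- For j = 0 the top row of U is zero, so an entry of B must be taken there. The cofactor at column
-- 0 is a full identity; the others still have an x-free column and lose another degree.
second-punctured {n} zero U B U0 U≡I = trans (cong₂ ℚ._+_
    (trans (cong₂ (λ u c → 1ℚ ℚ.* (u ℚ.* c₀ ℚ.+ B zero zero ℚ.* c)) (U0 zero)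
             (lead-identity (minor U zero) (minor B zero) λ i l → U≡I (suc i) l))
           (solve 2 (λ c b → con 1ℚ :* (con 0ℚ :* c :+ b :* con 1ℚ) := con 1ℚ :* b)
             refl c₀ (B zero zero)))
    (sum-zero _ (rest n U B U0 U≡I)))
  (ℚ.+-identityʳ _)
  where
  c₀ = detCoeff (minor U zero) (minor B zero) 1
  rest : ∀ n (U B : Q.Matrix (suc n)) → (∀ i → U i zero ≡ 0ℚ) →
    (∀ i l → U i (suc l) ≡ Q.scalar 1ℚ i (punchIn zero l)) → (l : Fin n) →
    Q.sign (suc (toℕ l)) ℚ.* (U zero (suc l) ℚ.* detCoeff (minor U (suc l)) (minor B (suc l)) 1
      ℚ.+ B zero (suc l) ℚ.* detCoeff (minor U (suc l)) (minor B (suc l)) 0) ≡ 0ℚ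
  rest (suc n) U B U0 U≡I l =
    trans (cong₂ (λ u c → s ℚ.* (u ℚ.* c₁ ℚ.+ B zero (suc l) ℚ.* c)) (U≡I zero l)
            (lead-zero-column (minor U (suc l)) (minor B (suc l)) λ i → U0 (suc i)))
      (solve 3 (λ s c b → s :* (con 0ℚ :* c :+ b :* con 0ℚ) := con 0ℚ)
        refl s c₁ (B zero (suc l)))
    where
    s  = Q.sign (suc (toℕ l))
    c₁ = detCoeff (minor U (suc l)) (minor B (suc l)) 1
-- Now the top row of U has its only 1 in column 1. The cofactor there is of the same kind with j in
-- place of j + 1, and the sign -1 of column 1 turns `sign j` into `sign (suc j)`.
second-punctured {suc n} (suc j) U B U0 U≡I = trans (cong₂ ℚ._+_
    (trans (cong₂ (λ u c → 1ℚ ℚ.* (u ℚ.* c₀ ℚ.+ B zero zero ℚ.* c)) (U0 zero)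
             (lead-zero-column (minor U zero) (minor B zero) λ i → U≡I (suc i) zero))
           (solve 2 (λ c b → con 1ℚ :* (con 0ℚ :* c :+ b :* con 0ℚ) := con 0ℚ)
             refl c₀ (B zero zero)))
    (cong₂ ℚ._+_
      (trans (cong₃ (λ u c e → ℚ.- 1ℚ ℚ.* (u ℚ.* c ℚ.+ b₁ ℚ.* e)) (U≡I zero zero)
               (second-punctured j (minor U (suc zero)) (minor B (suc zero))
                 (λ i → U0 (suc i)) (λ i l → U≡I (suc i) (suc l)))
               (lead-zero-column (minor U (suc zero)) (minor B (suc zero)) λ i → U0 (suc i)))
             (solve 3 (λ s b b₁ → :- con 1ℚ :* (con 1ℚ :* (s :* b) :+ b₁ :* con 0ℚ) := :- s :* b)
               refl (Q.sign (toℕ j)) (B (suc j) zero) b₁))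
      (sum-zero _ λ l →
        trans (cong₂ (λ u c → s l ℚ.* (u ℚ.* c₁ l ℚ.+ B zero (suc (suc l)) ℚ.* c))
                (U≡I zero (suc l))
                (lead-zero-column (minor U (suc (suc l))) (minor B (suc (suc l))) λ i → U0 (suc i)))
          (solve 3 (λ s c b → s :* (con 0ℚ :* c :+ b :* con 0ℚ) := con 0ℚ)
            refl (s l) (c₁ l) (B zero (suc (suc l)))))))
  (solve 1 (λ x → con 0ℚ :+ (x :+ con 0ℚ) := x) refl
    (ℚ.- Q.sign (toℕ j) ℚ.* B (suc j) zero))
  where
  cong₃ : ∀ {A : Set} (f : A → A → A → A) {a a′ b b′ c c′} →
    a ≡ a′ → b ≡ b′ → c ≡ c′ → f a b c ≡ f a′ b′ c′
  cong₃ f refl refl refl = refl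
  c₀ = detCoeff (minor U zero) (minor B zero) 1
  b₁ = B zero (suc zero)
  s c₁ : Fin n → ℚ
  s l  = Q.sign (suc (suc (toℕ l)))
  c₁ l = detCoeff (minor U (suc (suc l))) (minor B (suc (suc l))) 1

-- The trace of B, with one diagonal entry split off: the cofactors of columns l + 1 meet a zero of
-- U in the top row and an x-free column below it.
second-identity : ∀ {n} (U B : Q.Matrix (suc n)) → IsIdentity U →
  detCoeff U B 1 ≡ detCoeff (minor U zero) (minor B zero) 1 ℚ.+ B zero zero
second-identity {n} U B U≡I = trans (cong₂ ℚ._+_
    (trans (cong₂ (λ u c → 1ℚ ℚ.* (u ℚ.* c₀ ℚ.+ B zero zero ℚ.* c)) (U≡I zero zero)
             (lead-identity (minor U zero) (minor B zero) (minor-identity U U≡I)))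
           (solve 2 (λ c b → con 1ℚ :* (con 1ℚ :* c :+ b :* con 1ℚ) := c :+ b)
             refl c₀ (B zero zero)))
    (sum-zero _ (rest n U B U≡I)))
  (ℚ.+-identityʳ _)
  where
  c₀ = detCoeff (minor U zero) (minor B zero) 1
  rest : ∀ n (U B : Q.Matrix (suc n)) → IsIdentity U → (l : Fin n) →
    Q.sign (suc (toℕ l)) ℚ.* (U zero (suc l) ℚ.* detCoeff (minor U (suc l)) (minor B (suc l)) 1
      ℚ.+ B zero (suc l) ℚ.* detCoeff (minor U (suc l)) (minor B (suc l)) 0) ≡ 0ℚ
  rest (suc n) U B U≡I l =
    trans (cong₂ (λ u c → s ℚ.* (u ℚ.* c₁ ℚ.+ B zero (suc l) ℚ.* c)) (U≡I zero (suc l))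
            (lead-zero-column (minor U (suc l)) (minor B (suc l)) λ i → U≡I (suc i) zero))
      (solve 3 (λ s c b → s :* (con 0ℚ :* c :+ b :* con 0ℚ) := con 0ℚ)
        refl s c₁ (B zero (suc l)))
    where
    s  = Q.sign (suc (toℕ l))
    c₁ = detCoeff (minor U (suc l)) (minor B (suc l)) 1

sign² : ∀ k → Q.sign k ℚ.* Q.sign k ≡ 1ℚ
sign² zero    = refl
sign² (suc k) =
  trans (solve 1 (λ s → :- s :* :- s := s :* s) refl (Q.sign k)) (sign² k)

-- The sum of the principal 2×2 minors of B, with those through row 0 split off. Their diagonal
-- products are collected in B₀₀ times the trace of the rest. The product across the diagonal comes
-- from the cofactor of column l + 1, an instance of `second-punctured`; its sign and the sign of
-- the column differ by one power of -1, hence the minus.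
third-identity : ∀ {n} (U B : Q.Matrix (suc n)) → IsIdentity U →
  detCoeff U B 2 ≡ (detCoeff (minor U zero) (minor B zero) 2
      ℚ.+ B zero zero ℚ.* detCoeff (minor U zero) (minor B zero) 1)
    ℚ.+ sum (λ l → ℚ.- (B zero (suc l) ℚ.* B (suc l) zero))
third-identity {n} U B U≡I = cong₂ ℚ._+_
  (trans (cong (λ u → 1ℚ ℚ.* (u ℚ.* c₂ ℚ.+ B zero zero ℚ.* c₁)) (U≡I zero zero))
         (solve 3 (λ c b d → con 1ℚ :* (con 1ℚ :* c :+ b :* d) := c :+ b :* d)
           refl c₂ (B zero zero) c₁))
  (sum-cong-≗ (rest n U B U≡I))
  where
  c₁ = detCoeff (minor U zero) (minor B zero) 1
  c₂ = detCoeff (minor U zero) (minor B zero) 2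
  rest : ∀ n (U B : Q.Matrix (suc n)) → IsIdentity U → (l : Fin n) →
    Q.sign (suc (toℕ l)) ℚ.* (U zero (suc l) ℚ.* detCoeff (minor U (suc l)) (minor B (suc l)) 2
      ℚ.+ B zero (suc l) ℚ.* detCoeff (minor U (suc l)) (minor B (suc l)) 1)
    ≡ ℚ.- (B zero (suc l) ℚ.* B (suc l) zero)
  rest (suc n) U B U≡I l = begin
    ℚ.- s ℚ.* (U zero (suc l) ℚ.* d ℚ.+ b ℚ.* detCoeff (minor U (suc l)) (minor B (suc l)) 1)
      ≡⟨ cong₂ (λ u c → ℚ.- s ℚ.* (u ℚ.* d ℚ.+ b ℚ.* c)) (U≡I zero (suc l))
           (second-punctured l (minor U (suc l)) (minor B (suc l))
             (λ i → U≡I (suc i) zero) (λ i k → U≡I (suc i) (suc (punchIn l k)))) ⟩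
    ℚ.- s ℚ.* (0ℚ ℚ.* d ℚ.+ b ℚ.* (s ℚ.* b′))
      ≡⟨ solve 4 (λ s d b b′ → :- s :* (con 0ℚ :* d :+ b :* (s :* b′))
                    := (s :* s) :* (:- (b :* b′))) refl s d b b′ ⟩
    (s ℚ.* s) ℚ.* (ℚ.- (b ℚ.* b′))
      ≡⟨ cong (ℚ._* (ℚ.- (b ℚ.* b′))) (sign² (toℕ l)) ⟩
    1ℚ ℚ.* (ℚ.- (b ℚ.* b′))
      ≡⟨ ℚ.*-identityˡ _ ⟩
    ℚ.- (b ℚ.* b′) ∎
    where
    open ≡-Reasoning
    s  = Q.sign (toℕ l)
    b  = B zero (suc l)
    b′ = B (suc l) zero
    d  = detCoeff (minor U (suc l)) (minor B (suc l)) 2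

-- The coefficients of ∏ᵢ (x − rᵢ).
rootCoeff : ∀ {n} → Vector ℚ n → ℕ → ℚ
rootCoeff {zero}  r zero    = 1ℚ
rootCoeff {zero}  r (suc i) = 0ℚ
rootCoeff {suc n} r i       = rootCoeff (tail r) i ℚ.- r zero ℚ.* shift (rootCoeff (tail r)) i

rootCoeff-above : ∀ {n} (r : Vector ℚ n) i → n ℕ.< i → rootCoeff r i ≡ 0ℚ
rootCoeff-above {zero}  r (suc i) _ = refl
rootCoeff-above {suc n} r (suc i) (ℕ.s≤s n<i) =
  trans (cong₂ (λ p q → p ℚ.- r zero ℚ.* q)
          (rootCoeff-above (tail r) (suc i) (ℕ.s≤s (ℕ.<⇒≤ n<i)))
          (rootCoeff-above (tail r) i n<i))
    (solve 1 (λ a → con 0ℚ :- a :* con 0ℚ := con 0ℚ) refl (r zero))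

lead-roots : ∀ {n} (r : Vector ℚ n) → rootCoeff r 0 ≡ 1ℚ
lead-roots {zero}  r = refl
lead-roots {suc n} r = trans (cong (λ c → c ℚ.- r zero ℚ.* 0ℚ) (lead-roots (tail r)))
  (solve 1 (λ a → con 1ℚ :- a :* con 0ℚ := con 1ℚ) refl (r zero))

-- Newton's identity p₂ = e₁² - 2e₂; `rootCoeff r 1` is -e₁, and the sign is lost in the square. A
-- new root a changes c₁ to c₁ - a and c₂ to c₂ - a c₁, so the cross terms cancel and a² remains.
newton : ∀ {n} (r : Vector ℚ n) →
  rootCoeff r 1 ℚ.* rootCoeff r 1 ℚ.- (rootCoeff r 2 ℚ.+ rootCoeff r 2)
    ≡ sum λ i → r i ℚ.* r i
newton {zero}  r = refl
newton {suc n} r = begin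
  (c₁ ℚ.- a ℚ.* c₀) ℚ.* (c₁ ℚ.- a ℚ.* c₀) ℚ.- ((c₂ ℚ.- a ℚ.* c₁) ℚ.+ (c₂ ℚ.- a ℚ.* c₁))
    ≡⟨ cong (λ c → (c₁ ℚ.- a ℚ.* c) ℚ.* (c₁ ℚ.- a ℚ.* c)
                     ℚ.- ((c₂ ℚ.- a ℚ.* c₁) ℚ.+ (c₂ ℚ.- a ℚ.* c₁))) (lead-roots (tail r)) ⟩
  (c₁ ℚ.- a ℚ.* 1ℚ) ℚ.* (c₁ ℚ.- a ℚ.* 1ℚ) ℚ.- ((c₂ ℚ.- a ℚ.* c₁) ℚ.+ (c₂ ℚ.- a ℚ.* c₁))
    ≡⟨ solve 3 (λ a c d → (c :- a :* con 1ℚ) :* (c :- a :* con 1ℚ)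
                            :- ((d :- a :* c) :+ (d :- a :* c))
                  := a :* a :+ (c :* c :- (d :+ d))) refl a c₁ c₂ ⟩
  a ℚ.* a ℚ.+ (c₁ ℚ.* c₁ ℚ.- (c₂ ℚ.+ c₂))
    ≡⟨ cong (a ℚ.* a ℚ.+_) (newton (tail r)) ⟩
  (sum λ i → r i ℚ.* r i) ∎
  where
  open ≡-Reasoning
  a  = r zero
  c₀ = rootCoeff (tail r) 0
  c₁ = rootCoeff (tail r) 1
  c₂ = rootCoeff (tail r) 2

-- A map to ℚ that preserves the ring operations, though not necessarily _≈_:
-- taking the m-th term of a real number is one.
record IsRawRingHom {a ℓ} (R : RawRing a ℓ) (φ : RawRing.Carrier R → ℚ) : Set a where
  private module R = RawRing R
  field
    +-homo  : ∀ x y → φ (x R.+ y) ≡ φ x ℚ.+ φ y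
    *-homo  : ∀ x y → φ (x R.* y) ≡ φ x ℚ.* φ y
    -‿homo  : ∀ x → φ (R.- x) ≡ ℚ.- φ x
    0#-homo : φ R.0# ≡ 0ℚ
    1#-homo : φ R.1# ≡ 1ℚ

module _ {a ℓ} {R : RawRing a ℓ} {φ : RawRing.Carrier R → ℚ} (hom : IsRawRingHom R φ) where
  open IsRawRingHom hom
  private
    module R = RawRing R
    module L = Linear R

  ∑-homo : ∀ {n} (f : Vector R.Carrier n) → φ (L.∑ f) ≡ sum λ i → φ (f i)
  ∑-homo {zero}  f = 0#-homo
  ∑-homo {suc n} f = trans (+-homo (f zero) _) (cong (φ (f zero) ℚ.+_) (∑-homo (tail f)))

  sign-homo : ∀ k → φ (L.sign k) ≡ Q.sign k
  sign-homo zero    = 1#-homo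
  sign-homo (suc k) = trans (-‿homo (L.sign k)) (cong ℚ.-_ (sign-homo k))

  -- The hypothesis on the entries is inherited by every minor, which would fail with the identity
  -- in place of U.
  det-homo : ∀ {n} (A : L.Matrix n) (U B : Q.Matrix n) x →
    (∀ i j → φ (A i j) ≡ x ℚ.* U i j ℚ.+ B i j) →
    φ (L.det A) ≡ horner n (detCoeff U B) x
  det-homo {zero}  A U B x eq = 1#-homo
  det-homo {suc n} A U B x eq = begin
    φ (L.det A)
      ≡⟨ ∑-homo (λ j → (L.sign (toℕ j) R.* A zero j) R.* d j) ⟩
    sum (λ j → φ ((L.sign (toℕ j) R.* A zero j) R.* d j))
      ≡⟨ sum-cong-≗ term ⟩
    sum (λ j → horner (suc n) (λ i → s j ℚ.* (u j ℚ.* c j i ℚ.+ b j ℚ.* shift (c j) i)) x)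
      ≡⟨ horner-sum (suc n) (λ j i → s j ℚ.* (u j ℚ.* c j i ℚ.+ b j ℚ.* shift (c j) i)) x ⟨
    horner (suc n) (detCoeff U B) x ∎
    where
    open ≡-Reasoning
    d : Fin (suc n) → R.Carrier
    d j = L.det (λ i l → A (suc i) (punchIn j l))
    s u b : Fin (suc n) → ℚ
    s j = Q.sign (toℕ j)
    u j = U zero j
    b j = B zero j
    c : Fin (suc n) → ℕ → ℚ
    c j = detCoeff (minor U j) (minor B j)
    term : ∀ j → φ ((L.sign (toℕ j) R.* A zero j) R.* d j)
               ≡ horner (suc n) (λ i → s j ℚ.* (u j ℚ.* c j i ℚ.+ b j ℚ.* shift (c j) i)) x
    term j = begin
      φ ((L.sign (toℕ j) R.* A zero j) R.* d j)
        ≡⟨ trans (*-homo _ _) (cong (ℚ._* φ (d j)) (*-homo _ _)) ⟩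
      (φ (L.sign (toℕ j)) ℚ.* φ (A zero j)) ℚ.* φ (d j)
        ≡⟨ cong₂ ℚ._*_ (cong₂ ℚ._*_ (sign-homo (toℕ j)) (eq zero j))
             (det-homo (λ i l → A (suc i) (punchIn j l)) (minor U j) (minor B j) x
               λ i l → eq (suc i) (punchIn j l)) ⟩
      (s j ℚ.* (x ℚ.* u j ℚ.+ b j)) ℚ.* h
        ≡⟨ solve 5 (λ s x u b h → (s :* (x :* u :+ b)) :* h
                      := s :* (u :* (x :* h :+ con 0ℚ) :+ b :* h)) refl (s j) x (u j) (b j) h ⟩
      -- The added `0ℚ` stands for the coefficient of index n + 1, so that x times h becomes the
      -- same coefficient sequence read at formal degree n + 1.
      s j ℚ.* (u j ℚ.* (x ℚ.* h ℚ.+ 0ℚ) ℚ.+ b j ℚ.* h)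
        ≡⟨ cong₂ (λ p q → s j ℚ.* (u j ℚ.* (x ℚ.* h ℚ.+ p) ℚ.+ b j ℚ.* q))
             (detCoeff-above (minor U j) (minor B j) (suc n) (ℕ.s≤s ℕ.≤-refl))
             (horner-shift n (c j) x) ⟨
      s j ℚ.* (u j ℚ.* horner (suc n) (c j) x ℚ.+ b j ℚ.* horner (suc n) (shift (c j)) x)
        ≡⟨ cong (s j ℚ.*_) (cong₂ ℚ._+_ (horner-* (suc n) (u j) (c j) x)
                                        (horner-* (suc n) (b j) (shift (c j)) x)) ⟨
      s j ℚ.* (horner (suc n) (λ i → u j ℚ.* c j i) x
                ℚ.+ horner (suc n) (λ i → b j ℚ.* shift (c j) i) x)
        ≡⟨ cong (s j ℚ.*_) (horner-+ (suc n) (λ i → u j ℚ.* c j i)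
                                             (λ i → b j ℚ.* shift (c j) i) x) ⟨
      s j ℚ.* horner (suc n) (λ i → u j ℚ.* c j i ℚ.+ b j ℚ.* shift (c j) i) x
        ≡⟨ horner-* (suc n) (s j) (λ i → u j ℚ.* c j i ℚ.+ b j ℚ.* shift (c j) i) x ⟨
      horner (suc n) (λ i → s j ℚ.* (u j ℚ.* c j i ℚ.+ b j ℚ.* shift (c j) i)) x ∎
      where h = horner n (c j) x

  charPoly-homo : ∀ {n} (A : L.Matrix n) (B : Q.Matrix n) x →
    (∀ i j → φ (A i j) ≡ ℚ.- B i j) →
    φ (L.charPoly A x) ≡ horner n (detCoeff (Q.scalar 1ℚ) B) (φ x)
  charPoly-homo {n} A B x A≡-B =
    det-homo (λ i j → L.scalar x i j R.+ R.- A i j) (Q.scalar 1ℚ) B (φ x) entry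
    where
    scalar-entry : ∀ i j → φ (L.scalar x i j) ≡ φ x ℚ.* Q.scalar 1ℚ i j
    scalar-entry i j with i Fin.≟ j
    ... | yes _ = sym (ℚ.*-identityʳ (φ x))
    ... | no _  = trans 0#-homo (sym (ℚ.*-zeroʳ (φ x)))
    entry : ∀ i j → φ (L.scalar x i j R.+ R.- A i j) ≡ φ x ℚ.* Q.scalar 1ℚ i j ℚ.+ B i j
    entry i j = begin
      φ (L.scalar x i j R.+ R.- A i j)
        ≡⟨ trans (+-homo _ _) (cong₂ ℚ._+_ (scalar-entry i j) (-‿homo (A i j))) ⟩
      φ x ℚ.* Q.scalar 1ℚ i j ℚ.+ ℚ.- φ (A i j)
        ≡⟨ cong (λ a → φ x ℚ.* Q.scalar 1ℚ i j ℚ.+ ℚ.- a) (A≡-B i j) ⟩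
      φ x ℚ.* Q.scalar 1ℚ i j ℚ.+ ℚ.- (ℚ.- B i j)
        ≡⟨ cong (λ b → φ x ℚ.* Q.scalar 1ℚ i j ℚ.+ b)
             (solve 1 (λ b → :- (:- b) := b) refl (B i j)) ⟩
      φ x ℚ.* Q.scalar 1ℚ i j ℚ.+ B i j ∎
      where open ≡-Reasoning

  ∏-homo : ∀ {n} (f : Vector R.Carrier n) (r : Vector ℚ n) x →
    (∀ i → φ (f i) ≡ x ℚ.- r i) → φ (L.∏ f) ≡ horner n (rootCoeff r) x
  ∏-homo {zero}  f r x eq = 1#-homo
  ∏-homo {suc n} f r x eq = begin
    φ (f zero R.* L.∏ (tail f))
      ≡⟨ *-homo _ _ ⟩
    φ (f zero) ℚ.* φ (L.∏ (tail f))
      ≡⟨ cong₂ ℚ._*_ (eq zero) (∏-homo (tail f) (tail r) x (λ i → eq (suc i))) ⟩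
    (x ℚ.- r zero) ℚ.* h
      ≡⟨ solve 3 (λ x a h → (x :- a) :* h := (x :* h :+ con 0ℚ) :- a :* h) refl x (r zero) h ⟩
    (x ℚ.* h ℚ.+ 0ℚ) ℚ.- r zero ℚ.* h
      ≡⟨ cong₂ (λ p q → (x ℚ.* h ℚ.+ p) ℚ.- r zero ℚ.* q)
           (rootCoeff-above (tail r) (suc n) (ℕ.s≤s ℕ.≤-refl)) (horner-shift n c x) ⟨
    horner (suc n) c x ℚ.- r zero ℚ.* horner (suc n) (shift c) x
      ≡⟨ cong (λ p → horner (suc n) c x ℚ.- p) (horner-* (suc n) (r zero) (shift c) x) ⟨
    horner (suc n) c x ℚ.- horner (suc n) (λ i → r zero ℚ.* shift c i) x
      ≡⟨ horner-- (suc n) c (λ i → r zero ℚ.* shift c i) x ⟨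
    horner (suc n) (rootCoeff r) x ∎
    where
    open ≡-Reasoning
    c = rootCoeff (tail r)
    h = horner n c x

-- Rational estimates

fromℕ : ℕ → ℚ
fromℕ n = (+ n) ℚ./ 1

0≤fromℕ : ∀ n → 0ℚ ℚ.≤ fromℕ n
0≤fromℕ n = ℚ.nonNegative⁻¹ (fromℕ n) {{ℚ.normalize-nonNeg n 1}}

p≤∣p∣ : ∀ p → p ℚ.≤ ℚ.∣ p ∣
p≤∣p∣ p with ℚ.≤-total 0ℚ p
... | inj₁ 0≤p = ℚ.≤-reflexive (sym (ℚ.0≤p⇒∣p∣≡p 0≤p))
... | inj₂ p≤0 = ℚ.≤-trans p≤0 (ℚ.0≤∣p∣ p)

sum-≥ : ∀ {n} (f : Fin n → ℚ) {K} → (∀ i → ℚ.- f i ℚ.≤ K) → ℚ.- sum f ℚ.≤ fromℕ n ℚ.* K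
sum-≥ {zero}  f {K} f≥ = ℚ.≤-reflexive (solve 1 (λ k → :- con 0ℚ := con 0ℚ :* k) refl K)
sum-≥ {suc n} f {K} f≥ = begin
  ℚ.- (f zero ℚ.+ sum (tail f))       ≡⟨ ℚ.neg-distrib-+ (f zero) (sum (tail f)) ⟩
  ℚ.- f zero ℚ.+ ℚ.- sum (tail f)     ≤⟨ ℚ.+-mono-≤ (f≥ zero) (sum-≥ (tail f) λ i → f≥ (suc i)) ⟩
  K ℚ.+ fromℕ n ℚ.* K                 ≡⟨ solve 2 (λ k n → k :+ n :* k := (con 1ℚ :+ n) :* k)
                                           refl K (fromℕ n) ⟩
  (1ℚ ℚ.+ fromℕ n) ℚ.* K              ≡⟨ cong (ℚ._* K) (/-suc n 0) ⟨
  fromℕ (suc n) ℚ.* K                 ∎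
  where open ℚ.≤-Reasoning

second-hollow : ∀ {n} (U B : Q.Matrix n) → IsIdentity U → (∀ i → B i i ≡ 0ℚ) →
  detCoeff U B 1 ≡ 0ℚ
second-hollow {zero}  U B U≡I B≡0 = refl
second-hollow {suc n} U B U≡I B≡0 = trans (second-identity U B U≡I) (trans
  (cong₂ ℚ._+_ (second-hollow (minor U zero) (minor B zero) (minor-identity U U≡I)
                  λ i → B≡0 (suc i)) (B≡0 zero))
  (ℚ.+-identityʳ 0ℚ))

-- With zero diagonal, -2 times the third coefficient is ∑ BᵢⱼBⱼᵢ over ordered pairs i ≠ j. Row and
-- column 0 contribute n products, each counted twice, and n(n - 1) + 2n = (n + 1)n.
third-hollow : ∀ {n} (U B : Q.Matrix n) D → IsIdentity U → (∀ i → B i i ≡ 0ℚ) →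
  (∀ i j → ℚ.∣ B i j ∣ ℚ.≤ D) →
  ℚ.- (detCoeff U B 2 ℚ.+ detCoeff U B 2)
    ℚ.≤ (fromℕ n ℚ.* (fromℕ n ℚ.- 1ℚ)) ℚ.* (D ℚ.* D)
third-hollow {zero}  U B D U≡I B≡0 ∣B∣≤D = ℚ.≤-reflexive
  (solve 1 (λ k → :- (con 0ℚ :+ con 0ℚ) := (con 0ℚ :* (con 0ℚ :- con 1ℚ)) :* k) refl (D ℚ.* D))
third-hollow {suc n} U B D U≡I B≡0 ∣B∣≤D = begin
  ℚ.- (detCoeff U B 2 ℚ.+ detCoeff U B 2)
    ≡⟨ cong (λ c → ℚ.- (c ℚ.+ c)) (third-identity U B U≡I) ⟩
  ℚ.- (((c₂ ℚ.+ B zero zero ℚ.* c₁) ℚ.+ s) ℚ.+ ((c₂ ℚ.+ B zero zero ℚ.* c₁) ℚ.+ s))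
    ≡⟨ cong (λ b → ℚ.- (((c₂ ℚ.+ b ℚ.* c₁) ℚ.+ s) ℚ.+ ((c₂ ℚ.+ b ℚ.* c₁) ℚ.+ s))) (B≡0 zero) ⟩
  ℚ.- (((c₂ ℚ.+ 0ℚ ℚ.* c₁) ℚ.+ s) ℚ.+ ((c₂ ℚ.+ 0ℚ ℚ.* c₁) ℚ.+ s))
    ≡⟨ solve 3 (λ c d s → :- (((c :+ con 0ℚ :* d) :+ s) :+ ((c :+ con 0ℚ :* d) :+ s))
                  := :- (c :+ c) :+ (:- s :+ :- s)) refl c₂ c₁ s ⟩
  ℚ.- (c₂ ℚ.+ c₂) ℚ.+ (ℚ.- s ℚ.+ ℚ.- s)
    ≤⟨ ℚ.+-mono-≤ (third-hollow (minor U zero) (minor B zero) D (minor-identity U U≡I)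
                     (λ i → B≡0 (suc i)) (λ i j → ∣B∣≤D (suc i) (suc j)))
                  (ℚ.+-mono-≤ -s≤ -s≤) ⟩
  (k ℚ.* (k ℚ.- 1ℚ)) ℚ.* (D ℚ.* D) ℚ.+ (k ℚ.* (D ℚ.* D) ℚ.+ k ℚ.* (D ℚ.* D))
    ≡⟨ solve 2 (λ k e → (k :* (k :- con 1ℚ)) :* e :+ (k :* e :+ k :* e)
                  := ((con 1ℚ :+ k) :* ((con 1ℚ :+ k) :- con 1ℚ)) :* e) refl k (D ℚ.* D) ⟩
  ((1ℚ ℚ.+ k) ℚ.* ((1ℚ ℚ.+ k) ℚ.- 1ℚ)) ℚ.* (D ℚ.* D)
    ≡⟨ cong (λ l → (l ℚ.* (l ℚ.- 1ℚ)) ℚ.* (D ℚ.* D)) (/-suc n 0) ⟨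
  (fromℕ (suc n) ℚ.* (fromℕ (suc n) ℚ.- 1ℚ)) ℚ.* (D ℚ.* D) ∎
  where
  open ℚ.≤-Reasoning
  k  = fromℕ n
  c₁ = detCoeff (minor U zero) (minor B zero) 1
  c₂ = detCoeff (minor U zero) (minor B zero) 2
  s  = sum λ l → ℚ.- (B zero (suc l) ℚ.* B (suc l) zero)
  -s≤ : ℚ.- s ℚ.≤ k ℚ.* (D ℚ.* D)
  -s≤ = sum-≥ (λ l → ℚ.- (B zero (suc l) ℚ.* B (suc l) zero)) λ l → begin
    ℚ.- (ℚ.- (B zero (suc l) ℚ.* B (suc l) zero))
      ≡⟨ solve 1 (λ x → :- (:- x) := x) refl (B zero (suc l) ℚ.* B (suc l) zero) ⟩
    B zero (suc l) ℚ.* B (suc l) zero          ≤⟨ p≤∣p∣ _ ⟩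
    ℚ.∣ B zero (suc l) ℚ.* B (suc l) zero ∣
      ≤⟨ ∣p*q∣≤ {B zero (suc l)} {B (suc l) zero} (∣B∣≤D zero (suc l)) (∣B∣≤D (suc l) zero) ⟩
    D ℚ.* D ∎

0≤p*p : ∀ p → 0ℚ ℚ.≤ p ℚ.* p
0≤p*p p with ℚ.≤-total 0ℚ p
... | inj₁ 0≤p = ℚ.nonNegative⁻¹ _ {{ℚ.nonNeg*nonNeg⇒nonNeg p {{ℚ.nonNegative 0≤p}} p {{ℚ.nonNegative 0≤p}}}}
... | inj₂ p≤0 = ℚ.nonNegative⁻¹ _ {{ℚ.nonPos*nonPos⇒nonPos p {{ℚ.nonPositive p≤0}} p {{ℚ.nonPositive p≤0}}}}

0≤p*q : ∀ {p q} → 0ℚ ℚ.≤ p → 0ℚ ℚ.≤ q → 0ℚ ℚ.≤ p ℚ.* q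
0≤p*q {p} {q} 0≤p 0≤q = ℚ.nonNegative⁻¹ _
  {{ℚ.nonNeg*nonNeg⇒nonNeg p {{ℚ.nonNegative 0≤p}} q {{ℚ.nonNegative 0≤q}}}}

∣p∣*∣p∣≡p*p : ∀ p → ℚ.∣ p ∣ ℚ.* ℚ.∣ p ∣ ≡ p ℚ.* p
∣p∣*∣p∣≡p*p p = trans (sym (ℚ.∣p*q∣≡∣p∣*∣q∣ p p)) (ℚ.0≤p⇒∣p∣≡p (0≤p*p p))

p≤p+q : ∀ p {q} → 0ℚ ℚ.≤ q → p ℚ.≤ p ℚ.+ q
p≤p+q p {q} 0≤q = subst (ℚ._≤ p ℚ.+ q) (ℚ.+-identityʳ p) (ℚ.+-monoʳ-≤ p 0≤q)

square-cancel-≤ : ∀ {p q} → 0ℚ ℚ.≤ q → p ℚ.* p ℚ.≤ q ℚ.* q → p ℚ.≤ q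
square-cancel-≤ {p} {q} 0≤q p²≤q² with p ℚ.≤? q
... | yes p≤q = p≤q
... | no  p≰q = contradiction (ℚ.≤-<-trans p²≤q² q²<p²) (ℚ.<-irrefl refl)
  where
  q<p = ℚ.≰⇒> p≰q
  q²<p² : q ℚ.* q ℚ.< p ℚ.* p
  q²<p² = ℚ.≤-<-trans (ℚ.*-monoˡ-≤-nonNeg q {{ℚ.nonNegative 0≤q}} (ℚ.<⇒≤ q<p))
    (ℚ.*-monoˡ-<-pos p {{ℚ.positive (ℚ.≤-<-trans 0≤q q<p)}} q<p)

young : ∀ a b → a ℚ.* b ℚ.+ a ℚ.* b ℚ.≤ a ℚ.* a ℚ.+ b ℚ.* b
young a b = begin
  a ℚ.* b ℚ.+ a ℚ.* b                                  ≤⟨ p≤p+q _ (0≤p*p (a ℚ.- b)) ⟩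
  (a ℚ.* b ℚ.+ a ℚ.* b) ℚ.+ (a ℚ.- b) ℚ.* (a ℚ.- b)
    ≡⟨ solve 2 (λ a b → (a :* b :+ a :* b) :+ (a :- b) :* (a :- b) := a :* a :+ b :* b) refl a b ⟩
  a ℚ.* a ℚ.+ b ℚ.* b                                  ∎
  where open ℚ.≤-Reasoning

-- Controls the cross term 2a ∑ f that arises in `cauchy-schwarz` when the square of a + ∑ f is
-- expanded.
sum-young : ∀ {n} a (f : Vector ℚ n) →
  a ℚ.* sum f ℚ.+ a ℚ.* sum f ℚ.≤ fromℕ n ℚ.* (a ℚ.* a) ℚ.+ sum (λ i → f i ℚ.* f i)
sum-young {zero}  a f = ℚ.≤-reflexive
  (solve 1 (λ a → a :* con 0ℚ :+ a :* con 0ℚ := con 0ℚ :* (a :* a) :+ con 0ℚ) refl a)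
sum-young {suc n} a f = begin
  a ℚ.* (f zero ℚ.+ s) ℚ.+ a ℚ.* (f zero ℚ.+ s)
    ≡⟨ solve 3 (λ a b s → a :* (b :+ s) :+ a :* (b :+ s)
                  := (a :* b :+ a :* b) :+ (a :* s :+ a :* s)) refl a (f zero) s ⟩
  (a ℚ.* f zero ℚ.+ a ℚ.* f zero) ℚ.+ (a ℚ.* s ℚ.+ a ℚ.* s)
    ≤⟨ ℚ.+-mono-≤ (young a (f zero)) (sum-young a (tail f)) ⟩
  (a ℚ.* a ℚ.+ f zero ℚ.* f zero) ℚ.+ (fromℕ n ℚ.* (a ℚ.* a) ℚ.+ t)
    ≡⟨ solve 4 (λ e b n t → (e :+ b) :+ (n :* e :+ t) := (con 1ℚ :+ n) :* e :+ (b :+ t))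
         refl (a ℚ.* a) (f zero ℚ.* f zero) (fromℕ n) t ⟩
  (1ℚ ℚ.+ fromℕ n) ℚ.* (a ℚ.* a) ℚ.+ (f zero ℚ.* f zero ℚ.+ t)
    ≡⟨ cong (λ k → k ℚ.* (a ℚ.* a) ℚ.+ (f zero ℚ.* f zero ℚ.+ t)) (/-suc n 0) ⟨
  fromℕ (suc n) ℚ.* (a ℚ.* a) ℚ.+ (f zero ℚ.* f zero ℚ.+ t) ∎
  where
  open ℚ.≤-Reasoning
  s = sum (tail f)
  t = sum (λ i → tail f i ℚ.* tail f i)

cauchy-schwarz : ∀ {n} (f : Vector ℚ n) →
  sum f ℚ.* sum f ℚ.≤ fromℕ n ℚ.* sum (λ i → f i ℚ.* f i)
cauchy-schwarz {zero}  f = ℚ.≤-refl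
cauchy-schwarz {suc n} f = begin
  (a ℚ.+ s) ℚ.* (a ℚ.+ s)
    ≡⟨ solve 2 (λ a s → (a :+ s) :* (a :+ s) := (a :* a :+ (a :* s :+ a :* s)) :+ s :* s)
         refl a s ⟩
  (a ℚ.* a ℚ.+ (a ℚ.* s ℚ.+ a ℚ.* s)) ℚ.+ s ℚ.* s
    ≤⟨ ℚ.+-mono-≤ (ℚ.+-monoʳ-≤ (a ℚ.* a) (sum-young a (tail f))) (cauchy-schwarz (tail f)) ⟩
  (a ℚ.* a ℚ.+ (k ℚ.* (a ℚ.* a) ℚ.+ t)) ℚ.+ k ℚ.* t
    ≡⟨ solve 3 (λ e k t → (e :+ (k :* e :+ t)) :+ k :* t := (con 1ℚ :+ k) :* (e :+ t))
         refl (a ℚ.* a) k t ⟩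
  (1ℚ ℚ.+ k) ℚ.* (a ℚ.* a ℚ.+ t)
    ≡⟨ cong (ℚ._* (a ℚ.* a ℚ.+ t)) (/-suc n 0) ⟨
  fromℕ (suc n) ℚ.* (a ℚ.* a ℚ.+ t) ∎
  where
  open ℚ.≤-Reasoning
  k = fromℕ n
  a = f zero
  s = sum (tail f)
  t = sum (λ i → tail f i ℚ.* tail f i)

/-* : ∀ a j b k → (+ a) ℚ./ suc j ℚ.* ((+ b) ℚ./ suc k) ≡ (+ (a ℕ.* b)) ℚ./ (suc j ℕ.* suc k)
/-* a j b k = ℚ.toℚᵘ-injective (begin
  ℚ.toℚᵘ ((+ a) ℚ./ suc j ℚ.* ((+ b) ℚ./ suc k))
    ≈⟨ ℚ.toℚᵘ-homo-* ((+ a) ℚ./ suc j) ((+ b) ℚ./ suc k) ⟩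
  ℚ.toℚᵘ ((+ a) ℚ./ suc j) ℚᵘ.* ℚ.toℚᵘ ((+ b) ℚ./ suc k)
    ≈⟨ ℚᵘ.*-cong (ℚ.toℚᵘ-fromℚᵘ (mkℚᵘ (+ a) j)) (ℚ.toℚᵘ-fromℚᵘ (mkℚᵘ (+ b) k)) ⟩
  mkℚᵘ (+ a) j ℚᵘ.* mkℚᵘ (+ b) k
    ≡⟨ cong (λ z → mkℚᵘ z (k ℕ.+ j ℕ.* suc k)) (ℤ.pos-* a b) ⟨
  mkℚᵘ (+ (a ℕ.* b)) (k ℕ.+ j ℕ.* suc k)
    ≈⟨ ℚ.toℚᵘ-fromℚᵘ (mkℚᵘ (+ (a ℕ.* b)) (k ℕ.+ j ℕ.* suc k)) ⟨
  ℚ.toℚᵘ ((+ (a ℕ.* b)) ℚ./ (suc j ℕ.* suc k)) ∎)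
  where open ℚᵘ.≃-Reasoning

/1-minus : ∀ a b → (+ a ℤ.- + b) ℚ./ 1 ≡ fromℕ a ℚ.- fromℕ b
/1-minus a b = ℚ.toℚᵘ-injective (begin
  ℚ.toℚᵘ ((+ a ℤ.- + b) ℚ./ 1)              ≈⟨ ℚ.toℚᵘ-fromℚᵘ (mkℚᵘ (+ a ℤ.- + b) 0) ⟩
  mkℚᵘ (+ a ℤ.- + b) 0                      ≈⟨ ℚᵘ.*≡* eq ⟩
  mkℚᵘ (+ a) 0 ℚᵘ.- mkℚᵘ (+ b) 0
    ≈⟨ ℚᵘ.+-cong (ℚ.toℚᵘ-fromℚᵘ (mkℚᵘ (+ a) 0))
         (ℚᵘ.-‿cong (ℚ.toℚᵘ-fromℚᵘ (mkℚᵘ (+ b) 0))) ⟨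
  ℚ.toℚᵘ (fromℕ a) ℚᵘ.- ℚ.toℚᵘ (fromℕ b)
    ≈⟨ ℚᵘ.+-cong (ℚᵘ.≃-refl {ℚ.toℚᵘ (fromℕ a)}) (ℚ.toℚᵘ-homo‿- (fromℕ b)) ⟨
  ℚ.toℚᵘ (fromℕ a) ℚᵘ.+ ℚ.toℚᵘ (ℚ.- fromℕ b)
    ≈⟨ ℚ.toℚᵘ-homo-+ (fromℕ a) (ℚ.- fromℕ b) ⟨
  ℚ.toℚᵘ (fromℕ a ℚ.- fromℕ b)              ∎)
  where
  open ℚᵘ.≃-Reasoning
  eq : (+ a ℤ.- + b) ℤ.* + 1 ≡ (+ a ℤ.* + 1 ℤ.+ (ℤ.- + b) ℤ.* + 1) ℤ.* + 1
  eq = cong (ℤ._* + 1) (sym (cong₂ ℤ._+_ (ℤ.*-identityʳ (+ a)) (ℤ.*-identityʳ (ℤ.- + b))))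

fromℕ-mono : ∀ {a b} → a ℕ.≤ b → fromℕ a ℚ.≤ fromℕ b
fromℕ-mono {a} {b} a≤b = /-mono a 0 b 0 (ℕ.*-monoˡ-≤ 1 a≤b)

-- `√-seq` rounds down, but it stands on the larger side of the energy bound, so it has to be
-- corrected by one unit 1/(j + 1) before its square dominates m.
√-seq-upper : ∀ m j → let y = √-seq m j ℚ.+ (+ 1) ℚ./ suc j in fromℕ m ℚ.≤ y ℚ.* y
√-seq-upper m j = begin
  fromℕ m
    ≤⟨ /-mono m 0 (suc p ℕ.* suc p) (j ℕ.+ j ℕ.* suc j) le ⟩
  (+ (suc p ℕ.* suc p)) ℚ./ (suc j ℕ.* suc j)
    ≡⟨ /-* (suc p) j (suc p) j ⟨
  (+ suc p) ℚ./ suc j ℚ.* ((+ suc p) ℚ./ suc j)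
    ≡⟨ cong (λ y → y ℚ.* y) (trans (/-suc p j) (ℚ.+-comm ((+ 1) ℚ./ suc j) (√-seq m j))) ⟩
  (√-seq m j ℚ.+ (+ 1) ℚ./ suc j) ℚ.* (√-seq m j ℚ.+ (+ 1) ℚ./ suc j) ∎
  where
  open ℚ.≤-Reasoning
  p = isqrt (m ℕ.* (suc j ℕ.* suc j))
  le : m ℕ.* (suc j ℕ.* suc j) ℕ.≤ (suc p ℕ.* suc p) ℕ.* 1
  le = subst (m ℕ.* (suc j ℕ.* suc j) ℕ.≤_) (sym (ℕ.*-identityʳ (suc p ℕ.* suc p)))
    (ℕ.<⇒≤ (proj₂ (isqrt-spec (m ℕ.* (suc j ℕ.* suc j)))))

-- Sequences tending to 0

Vanishes : (ℕ → ℚ) → Set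
Vanishes f = ∀ ε → 0ℚ ℚ.< ε → ∃[ N ] (∀ m → N ℕ.≤ m → ℚ.∣ f m ∣ ℚ.≤ ε)

vanishes-≤ : ∀ {f g} → (∀ m → ℚ.∣ f m ∣ ℚ.≤ ℚ.∣ g m ∣) → Vanishes g → Vanishes f
vanishes-≤ f≤g vg ε 0<ε = let N , g≤ε = vg ε 0<ε in
  N , λ m N≤m → ℚ.≤-trans (f≤g m) (g≤ε m N≤m)

vanishes-cong : ∀ {f g} → (∀ m → f m ≡ g m) → Vanishes g → Vanishes f
vanishes-cong f≡g = vanishes-≤ λ m → ℚ.≤-reflexive (cong ℚ.∣_∣ (f≡g m))

vanishes-+ : ∀ {f g} → Vanishes f → Vanishes g → Vanishes (λ m → f m ℚ.+ g m)
vanishes-+ {f} {g} vf vg ε 0<ε =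
  let N , f≤ = vf (½ ℚ.* ε) (½-pos 0<ε)
      M , g≤ = vg (½ ℚ.* ε) (½-pos 0<ε)
  in N ℕ.⊔ M , λ m h → ℚ.≤-trans (ℚ.∣p+q∣≤∣p∣+∣q∣ (f m) (g m))
       (ℚ.≤-trans (ℚ.+-mono-≤ (f≤ m (ℕ.m⊔n≤o⇒m≤o N M h)) (g≤ m (ℕ.m⊔n≤o⇒n≤o N M h)))
                  (ℚ.≤-reflexive (½+½ ε)))

vanishes-neg : ∀ {f} → Vanishes f → Vanishes (λ m → ℚ.- f m)
vanishes-neg {f} = vanishes-≤ λ m → ℚ.≤-reflexive (ℚ.∣-p∣≡∣p∣ (f m))

vanishes-scale : ∀ {f} a → Vanishes f → Vanishes (λ m → a ℚ.* f m)
vanishes-scale {f} a vf ε 0<ε =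
  let δ , 0<δ , δA≡ε = quotient ε A 0<ε 0<A
      N , f≤ = vf δ 0<δ
  in N , λ m N≤m → ℚ.≤-trans (∣p*q∣≤ {a} {f m} {A} {δ} ∣a∣≤A (f≤ m N≤m))
       (ℚ.≤-reflexive (trans (ℚ.*-comm A δ) δA≡ε))
  where
  A = 1ℚ ℚ.+ ℚ.∣ a ∣
  0<A : 0ℚ ℚ.< A
  0<A = ℚ.+-mono-<-≤ (ℚ.positive⁻¹ 1ℚ) (ℚ.0≤∣p∣ a)
  ∣a∣≤A : ℚ.∣ a ∣ ℚ.≤ A
  ∣a∣≤A = subst (ℚ._≤ A) (ℚ.+-identityˡ ℚ.∣ a ∣)
    (ℚ.+-monoˡ-≤ ℚ.∣ a ∣ (ℚ.<⇒≤ (ℚ.positive⁻¹ 1ℚ)))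

vanishes-* : ∀ {f g} → Vanishes f → Vanishes g → Vanishes (λ m → f m ℚ.* g m)
vanishes-* {f} {g} vf vg ε 0<ε =
  let N , f≤ = vf ε 0<ε
      M , g≤ = vg 1ℚ (ℚ.positive⁻¹ 1ℚ)
  in N ℕ.⊔ M , λ m h → ℚ.≤-trans
       (∣p*q∣≤ {f m} {g m} {ε} {1ℚ} (f≤ m (ℕ.m⊔n≤o⇒m≤o N M h)) (g≤ m (ℕ.m⊔n≤o⇒n≤o N M h)))
       (ℚ.≤-reflexive (ℚ.*-identityʳ ε))

-- From small values of a polynomial to small coefficients

-- Horner's scheme: the intermediate values at a are the coefficients of the quotient by x - a, and
-- the last one is the remainder.
synthetic-division : ∀ d c a x → horner (suc d) c x ≡
  horner (suc d) c a ℚ.+ (x ℚ.- a) ℚ.* horner d (λ i → horner i c a) x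
synthetic-division zero c a x =
  solve 4 (λ c₀ c₁ a x → x :* c₀ :+ c₁ := (a :* c₀ :+ c₁) :+ (x :- a) :* c₀)
    refl (c 0) (c 1) a x
synthetic-division (suc d) c a x =
  trans (cong (λ h → x ℚ.* h ℚ.+ c (suc (suc d))) (synthetic-division d c a x))
    (solve 5 (λ x a p q k → x :* (p :+ (x :- a) :* q) :+ k
                := (a :* p :+ k) :+ (x :- a) :* (x :* q :+ p))
      refl x a (horner (suc d) c a) (horner d (λ i → horner i c a) x) (c (suc (suc d))))

∣q∣≤∣p*q∣ : ∀ p q → 1ℚ ℚ.≤ p → ℚ.∣ q ∣ ℚ.≤ ℚ.∣ p ℚ.* q ∣
∣q∣≤∣p*q∣ p q 1≤p = begin
  ℚ.∣ q ∣                ≡⟨ ℚ.*-identityˡ ℚ.∣ q ∣ ⟨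
  1ℚ ℚ.* ℚ.∣ q ∣         ≤⟨ ℚ.*-monoʳ-≤-nonNeg ℚ.∣ q ∣ {{ℚ.∣-∣-nonNeg q}} 1≤p ⟩
  p ℚ.* ℚ.∣ q ∣          ≡⟨ cong (ℚ._* ℚ.∣ q ∣) (ℚ.0≤p⇒∣p∣≡p
                              (ℚ.≤-trans (ℚ.<⇒≤ (ℚ.positive⁻¹ 1ℚ)) 1≤p)) ⟨
  ℚ.∣ p ∣ ℚ.* ℚ.∣ q ∣    ≡⟨ ℚ.∣p*q∣≡∣p∣*∣q∣ p q ⟨
  ℚ.∣ p ℚ.* q ∣          ∎
  where open ℚ.≤-Reasoning

-- Dividing by x − a leaves a polynomial of smaller degree that is still small
-- for x ≥ a + 1, and the coefficients are recovered as cᵢ₊₁ = qᵢ₊₁ − a qᵢ.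
coefficients-vanish : ∀ d (c : ℕ → ℕ → ℚ) a →
  (∀ x → a ℚ.≤ x → Vanishes (λ m → horner d (c m) x)) →
  ∀ i → i ℕ.≤ d → Vanishes (λ m → c m i)
coefficients-vanish zero c a vc zero _ = vc a ℚ.≤-refl
coefficients-vanish (suc d) c a vc = coeff
  where
  q : ℕ → ℕ → ℚ
  q m i = horner i (c m) a
  a≤a+1 : a ℚ.≤ a ℚ.+ 1ℚ
  a≤a+1 = subst (ℚ._≤ a ℚ.+ 1ℚ) (ℚ.+-identityʳ a) (ℚ.+-monoʳ-≤ a (ℚ.<⇒≤ (ℚ.positive⁻¹ 1ℚ)))
  horner-q : ∀ x → a ℚ.+ 1ℚ ℚ.≤ x → Vanishes (λ m → horner d (q m) x)
  horner-q x a+1≤x = vanishes-≤ (λ m → ∣q∣≤∣p*q∣ (x ℚ.- a) (horner d (q m) x) 1≤x-a)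
    (vanishes-cong
      (λ m → trans
        (solve 2 (λ p r → r := (p :+ r) :+ :- p) refl
          (horner (suc d) (c m) a) ((x ℚ.- a) ℚ.* horner d (q m) x))
        (cong (ℚ._+ ℚ.- horner (suc d) (c m) a) (sym (synthetic-division d (c m) a x))))
      (vanishes-+ (vc x (ℚ.≤-trans a≤a+1 a+1≤x)) (vanishes-neg (vc a ℚ.≤-refl))))
    where
    1≤x-a : 1ℚ ℚ.≤ x ℚ.- a
    1≤x-a = subst (ℚ._≤ x ℚ.- a)
      (solve 1 (λ a → (a :+ con 1ℚ) :- a := con 1ℚ) refl a) (ℚ.+-monoˡ-≤ (ℚ.- a) a+1≤x)
  quot : ∀ i → i ℕ.≤ suc d → Vanishes (λ m → q m i)
  quot i i≤ with ℕ.m≤n⇒m<n∨m≡n i≤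
  ... | inj₁ (ℕ.s≤s i≤d) = coefficients-vanish d q (a ℚ.+ 1ℚ) horner-q i i≤d
  -- At the last index q is the remainder, that is, the value at a, and not a coefficient of the
  -- quotient.
  ... | inj₂ refl        = vc a ℚ.≤-refl
  coeff : ∀ i → i ℕ.≤ suc d → Vanishes (λ m → c m i)
  coeff zero    i≤ = quot zero i≤
  coeff (suc i) i≤ = vanishes-cong
    (λ m → solve 3 (λ a q k → k := (a :* q :+ k) :+ :- (a :* q)) refl a (q m i) (c m (suc i)))
    (vanishes-+ (quot (suc i) i≤)
      (vanishes-neg (vanishes-scale a (quot i (ℕ.≤-trans (ℕ.n≤1+n i) i≤)))))

-- Counting hyperedges

-- The members of the list whose first entry is b, with that entry dropped: the case split behind
-- Pascal's rule.
tailsOf : ∀ {n} → Bool → List (Subset (suc n)) → List (Subset n)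
tailsOf b     []                = []
tailsOf true  ((true  ∷ e) ∷ L) = e ∷ tailsOf true L
tailsOf true  ((false ∷ e) ∷ L) = tailsOf true L
tailsOf false ((true  ∷ e) ∷ L) = tailsOf false L
tailsOf false ((false ∷ e) ∷ L) = e ∷ tailsOf false L

length-tailsOf : ∀ {n} (L : List (Subset (suc n))) →
  length L ≡ length (tailsOf true L) ℕ.+ length (tailsOf false L)
length-tailsOf []                = refl
length-tailsOf ((true  ∷ e) ∷ L) = cong suc (length-tailsOf L)
length-tailsOf ((false ∷ e) ∷ L) =
  trans (cong suc (length-tailsOf L)) (sym (ℕ.+-suc _ _))

tailsOf-all : ∀ {n} b {P : Subset (suc n) → Set} {Q : Subset n → Set} →
  (∀ {e} → P (b ∷ e) → Q e) → ∀ {L} → All P L → All Q (tailsOf b L)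
tailsOf-all b     P⇒Q []                         = []
tailsOf-all true  P⇒Q {(true  ∷ _) ∷ _} (p ∷ ps) = P⇒Q p ∷ tailsOf-all true P⇒Q ps
tailsOf-all true  P⇒Q {(false ∷ _) ∷ _} (p ∷ ps) = tailsOf-all true P⇒Q ps
tailsOf-all false P⇒Q {(true  ∷ _) ∷ _} (p ∷ ps) = tailsOf-all false P⇒Q ps
tailsOf-all false P⇒Q {(false ∷ _) ∷ _} (p ∷ ps) = P⇒Q p ∷ tailsOf-all false P⇒Q ps

tailsOf-unique : ∀ {n} b {L : List (Subset (suc n))} → Unique L → Unique (tailsOf b L)
tailsOf-unique b     []                           = []
tailsOf-unique true  {(true  ∷ e) ∷ _} (e∉ ∷ u) =
  tailsOf-all true (λ e≢e′ eq → e≢e′ (cong (true ∷_) eq)) e∉ ∷ tailsOf-unique true u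
tailsOf-unique true  {(false ∷ _) ∷ _} (_ ∷ u)  = tailsOf-unique true u
tailsOf-unique false {(true  ∷ _) ∷ _} (_ ∷ u)  = tailsOf-unique false u
tailsOf-unique false {(false ∷ e) ∷ _} (e∉ ∷ u) =
  tailsOf-all false (λ e≢e′ eq → e≢e′ (cong (false ∷_) eq)) e∉ ∷ tailsOf-unique false u

nC0≡1 : ∀ n → n C 0 ≡ 1
nC0≡1 n = trans (nCk≡nC[n∸k] (ℕ.z≤n {n})) (nCn≡1 n)

-- Induction along Pascal's rule: sets that contain the first vertex lose it and one unit of size,
-- the others keep their size.
length-≤-C : ∀ n k {L : List (Subset n)} → Unique L → All (λ e → card e ≡ k) L →
  length L ℕ.≤ n C k
length-≤-C zero k {[]}              u                c          = ℕ.z≤n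
length-≤-C zero .0 {[] ∷ []}        u                (refl ∷ _) = ℕ.≤-refl
length-≤-C zero k {[] ∷ [] ∷ _}     ((e≢e ∷ _) ∷ _)  c          = contradiction refl e≢e
length-≤-C (suc n) zero {L} u c = begin
  length L                                            ≡⟨ length-tailsOf L ⟩
  length (tailsOf true L) ℕ.+ length (tailsOf false L)
    ≡⟨ cong (ℕ._+ length (tailsOf false L)) (none (tailsOf-all true {Q = λ _ → ⊥} (λ ()) c)) ⟩
  length (tailsOf false L)
    ≤⟨ length-≤-C n zero (tailsOf-unique false u) (tailsOf-all false (λ eq → eq) c) ⟩
  n C 0                                               ≡⟨ trans (nC0≡1 n) (sym (nC0≡1 (suc n))) ⟩
  suc n C 0                                           ∎
  where
  open ℕ.≤-Reasoning
  none : ∀ {A : Set} {xs : List A} → All (λ _ → ⊥) xs → length xs ≡ 0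
  none [] = refl
length-≤-C (suc n) (suc k) {L} u c = begin
  length L                                            ≡⟨ length-tailsOf L ⟩
  length (tailsOf true L) ℕ.+ length (tailsOf false L)
    ≤⟨ ℕ.+-mono-≤
         (length-≤-C n k (tailsOf-unique true u) (tailsOf-all true ℕ.suc-injective c))
         (length-≤-C n (suc k) (tailsOf-unique false u) (tailsOf-all false (λ eq → eq) c)) ⟩
  n C k ℕ.+ n C suc k                                 ≡⟨ nCk+nC[k+1]≡[n+1]C[k+1] n k ⟩
  suc n C suc k                                       ∎
  where open ℕ.≤-Reasoning

-- Injectivity is asked on P only, since `removeAt` at i identifies two sets that differ just in i;
-- it is injective among the sets that contain i.
map-unique : ∀ {A B : Set} {P : A → Set} (f : A → B) →
  (∀ {x y} → P x → P y → f x ≡ f y → x ≡ y) →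
  ∀ {xs} → Unique xs → All P xs → Unique (map f xs)
map-unique f inj []       []       = []
map-unique f inj (x∉ ∷ u) (p ∷ ps) =
  All.map⁺ (All.zipWith (λ (x≢y , q) eq → x≢y (inj p q eq)) (x∉ , ps)) ∷ map-unique f inj u ps

removeAt-injective : ∀ {n} (i : Fin (suc n)) {e e′ : Subset (suc n)} →
  lookup e i ≡ true → lookup e′ i ≡ true → removeAt e i ≡ removeAt e′ i → e ≡ e′
removeAt-injective i {e} {e′} i∈e i∈e′ eq = begin
  e                                        ≡⟨ insertAt-removeAt e i ⟨
  insertAt (removeAt e i) i (lookup e i)   ≡⟨ cong₂ (λ v b → insertAt v i b) eq (trans i∈e (sym i∈e′)) ⟩
  insertAt (removeAt e′ i) i (lookup e′ i) ≡⟨ insertAt-removeAt e′ i ⟩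
  e′                                       ∎
  where open ≡-Reasoning

card-removeAt : ∀ {n} (e : Subset (suc n)) i → lookup e i ≡ true →
  card e ≡ suc (card (removeAt e i))
card-removeAt (true  ∷ e)     zero    i∈e = refl
card-removeAt (true  ∷ b ∷ e) (suc i) i∈e = cong suc (card-removeAt (b ∷ e) i i∈e)
card-removeAt (false ∷ b ∷ e) (suc i) i∈e = card-removeAt (b ∷ e) i i∈e

-- Deleting i and then j, which by then sits at `j′`, maps the hyperedges through both vertices
-- injectively to k-subsets of the n remaining ones.
codegree-≤ : ∀ {n k} (ℋ : Hypergraph (suc (suc n))) → IsUniform (suc (suc k)) ℋ →
  ∀ i j → i ≢ j → codegree ℋ i j ℕ.≤ n C k
codegree-≤ {n} {k} ℋ uniform i j i≢j = begin
  length L                                       ≡⟨ length-map (λ e → removeAt e i) L ⟨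
  length L₁                                      ≡⟨ length-map (λ e → removeAt e j′) L₁ ⟨
  length (map (λ e → removeAt e j′) L₁)          ≤⟨ length-≤-C n k unique₂ card₂ ⟩
  n C k                                          ∎
  where
  open ℕ.≤-Reasoning
  both? = λ (e : Subset (suc (suc n))) → (i ∈? e) ×-dec (j ∈? e)
  L = filter both? (edges ℋ)
  L₁ = map (λ e → removeAt e i) L
  j′ = punchOut i≢j
  i∈ : All (λ e → lookup e i ≡ true) L
  i∈ = All.map (λ (p , _) → []=⇒lookup p) (All.all-filter both? (edges ℋ))
  j∈ : All (λ e → lookup e j ≡ true) L
  j∈ = All.map (λ (_ , p) → []=⇒lookup p) (All.all-filter both? (edges ℋ))
  j′∈ : All (λ e → lookup e j′ ≡ true) L₁
  j′∈ = All.map⁺ (All.map (λ {e} p → trans (removeAt-punchOut e i≢j) p) j∈)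
  card₁ : All (λ e → card e ≡ suc k) L₁
  card₁ = All.map⁺ (All.zipWith
    (λ {e} (p , c) → ℕ.suc-injective (trans (sym (card-removeAt e i p)) c))
    (i∈ , All.filter⁺ both? uniform))
  unique₂ : Unique (map (λ e → removeAt e j′) L₁)
  unique₂ = map-unique (λ e → removeAt e j′) (removeAt-injective j′)
    (map-unique (λ e → removeAt e i) (removeAt-injective i)
      (Unique.filter⁺ both? (unique ℋ)) i∈)
    j′∈
  card₂ : All (λ e → card e ≡ k) (map (λ e → removeAt e j′) L₁)
  card₂ = All.map⁺ (All.zipWith
    (λ {e} (p , c) → ℕ.suc-injective (trans (sym (card-removeAt e j′ p)) c))
    (j′∈ , card₁))

-- Spectra of real matrices

term-hom : ∀ m → IsRawRingHom ℝ-rawRing (λ x → seq x m)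
term-hom m = record
  { +-homo  = λ _ _ → refl
  ; *-homo  = λ _ _ → refl
  ; -‿homo  = λ _ → refl
  ; 0#-homo = refl
  ; 1#-homo = refl
  }

seq-charPoly : ∀ {n} (A : Matrix n) (B : Q.Matrix n) m x → (∀ i j → seq (A i j) m ≡ ℚ.- B i j) →
  seq (charPoly A x) m ≡ horner n (detCoeff (Q.scalar 1ℚ) B) (seq x m)
seq-charPoly A B m x = charPoly-homo (term-hom m) A B x

seq-roots : ∀ {n} (ρ : Vector ℝ n) m x →
  seq (∏ (λ i → x - ρ i)) m ≡ horner n (rootCoeff (λ i → seq (ρ i) m)) (seq x m)
seq-roots ρ m x = ∏-homo (term-hom m) (λ i → x - ρ i) (λ i → seq (ρ i) m) (seq x m) (λ i → refl)

-- At a constant sequence x, `spec` says precisely that the difference of the two rational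
-- polynomials vanishes at x as m grows; rational x ≥ 0 give enough points for
-- `coefficients-vanish`.
spectrum-coefficients : ∀ {n} (A : Matrix n) (ρ : Vector ℝ n) (B : Q.Matrix n) →
  (∀ i j m → seq (A i j) m ≡ ℚ.- B i j) → IsSpectrum A ρ → ∀ i → i ℕ.≤ n →
  Vanishes (λ m → detCoeff (Q.scalar 1ℚ) B i ℚ.- rootCoeff (λ l → seq (ρ l) m) i)
spectrum-coefficients {n} A ρ B A≡-B spec = coefficients-vanish n
  (λ m i → detCoeff (Q.scalar 1ℚ) B i ℚ.- rootCoeff (λ l → seq (ρ l) m) i) 0ℚ
  λ x _ → vanishes-cong
    (λ m → trans (horner-- n (detCoeff (Q.scalar 1ℚ) B) (rootCoeff (λ l → seq (ρ l) m)) x)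
      (sym (cong₂ ℚ._-_ (seq-charPoly A B m (fromℚ x) (λ i j → A≡-B i j m))
                        (seq-roots ρ m (fromℚ x)))))
    (spec (fromℚ x))

fromℕ-pred : ∀ {n} → 1 ℕ.≤ n → fromℕ n ℚ.- 1ℚ ≡ fromℕ (n ℕ.∸ 1)
fromℕ-pred {suc n} _ = trans (cong (ℚ._- 1ℚ) (/-suc n 0))
  (solve 1 (λ n → (con 1ℚ :+ n) :- con 1ℚ := n) refl (fromℕ n))

-- In use, N = n, s is the m-th term of √(n - 1) and h = 1/(m + 1) bounds its rounding error, W = ∑
-- |rᵢ|, P = ∑ rᵢ², and δ is the tolerance for the coefficients. With R = ND(s + h) + η, W² ≤
-- (ND)²(N - 1) + δN ≤ (ND(s + h))² + η² ≤ R². One η pays for δ, the other for h.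
absorb-errors : ∀ {N D s h η P δ W} →
  0ℚ ℚ.≤ N → 0ℚ ℚ.≤ D → 0ℚ ℚ.≤ s → 0ℚ ℚ.≤ h → 0ℚ ℚ.≤ η →
  W ℚ.* W ℚ.≤ N ℚ.* P → P ℚ.≤ (N ℚ.* (N ℚ.- 1ℚ)) ℚ.* (D ℚ.* D) ℚ.+ δ →
  δ ℚ.* N ≡ η ℚ.* η → N ℚ.- 1ℚ ℚ.≤ (s ℚ.+ h) ℚ.* (s ℚ.+ h) →
  (N ℚ.* D) ℚ.* h ℚ.≤ η → W ℚ.≤ (N ℚ.* s) ℚ.* D ℚ.+ (η ℚ.+ η)
absorb-errors {N} {D} {s} {h} {η} {P} {δ} {W} 0≤N 0≤D 0≤s 0≤h 0≤η W² P≤ δN≡η² N-1≤ NDh≤η =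
  begin
  W
    ≤⟨ square-cancel-≤ 0≤R W²≤R² ⟩
  (N ℚ.* D) ℚ.* (s ℚ.+ h) ℚ.+ η
    ≡⟨ solve 5 (λ N D s h η → (N :* D) :* (s :+ h) :+ η
                  := (N :* s) :* D :+ ((N :* D) :* h :+ η)) refl N D s h η ⟩
  (N ℚ.* s) ℚ.* D ℚ.+ ((N ℚ.* D) ℚ.* h ℚ.+ η)
    ≤⟨ ℚ.+-monoʳ-≤ ((N ℚ.* s) ℚ.* D) (ℚ.+-monoˡ-≤ η NDh≤η) ⟩
  (N ℚ.* s) ℚ.* D ℚ.+ (η ℚ.+ η) ∎
  where
  open ℚ.≤-Reasoning
  ND = N ℚ.* D
  y  = s ℚ.+ h
  R  = ND ℚ.* y ℚ.+ η
  0≤NDy : 0ℚ ℚ.≤ ND ℚ.* y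
  0≤NDy = 0≤p*q (0≤p*q 0≤N 0≤D) (ℚ.+-mono-≤ 0≤s 0≤h)
  0≤R : 0ℚ ℚ.≤ R
  0≤R = ℚ.+-mono-≤ 0≤NDy 0≤η
  0≤cross : 0ℚ ℚ.≤ (ND ℚ.* y) ℚ.* η ℚ.+ (ND ℚ.* y) ℚ.* η
  0≤cross = ℚ.+-mono-≤ (0≤p*q 0≤NDy 0≤η) (0≤p*q 0≤NDy 0≤η)
  W²≤R² : W ℚ.* W ℚ.≤ R ℚ.* R
  W²≤R² = begin
    W ℚ.* W
      ≤⟨ W² ⟩
    N ℚ.* P
      ≤⟨ ℚ.*-monoˡ-≤-nonNeg N {{ℚ.nonNegative 0≤N}} P≤ ⟩
    N ℚ.* ((N ℚ.* (N ℚ.- 1ℚ)) ℚ.* (D ℚ.* D) ℚ.+ δ)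
      ≡⟨ solve 4 (λ N M D δ → N :* ((N :* M) :* (D :* D) :+ δ)
                    := ((N :* D) :* (N :* D)) :* M :+ δ :* N) refl N (N ℚ.- 1ℚ) D δ ⟩
    (ND ℚ.* ND) ℚ.* (N ℚ.- 1ℚ) ℚ.+ δ ℚ.* N
      ≤⟨ ℚ.+-mono-≤ (ℚ.*-monoˡ-≤-nonNeg (ND ℚ.* ND) {{ℚ.nonNegative (0≤p*p ND)}} N-1≤)
                    (ℚ.≤-reflexive δN≡η²) ⟩
    (ND ℚ.* ND) ℚ.* (y ℚ.* y) ℚ.+ η ℚ.* η
      ≤⟨ p≤p+q _ 0≤cross ⟩
    ((ND ℚ.* ND) ℚ.* (y ℚ.* y) ℚ.+ η ℚ.* η) ℚ.+ ((ND ℚ.* y) ℚ.* η ℚ.+ (ND ℚ.* y) ℚ.* η)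
      ≡⟨ solve 3 (λ a y η → ((a :* a) :* (y :* y) :+ η :* η) :+ ((a :* y) :* η :+ (a :* y) :* η)
                    := (a :* y :+ η) :* (a :* y :+ η)) refl ND y η ⟩
    R ℚ.* R ∎

hollow-energy-≤ : ∀ {n} → 2 ℕ.≤ n → (A : Matrix n) (B : Q.Matrix n) (z : ℤ) →
  (∀ i j m → seq (A i j) m ≡ ℚ.- B i j) → (∀ i → B i i ≡ 0ℚ) →
  (∀ i j → ℚ.∣ B i j ∣ ℚ.≤ z ℚ./ 1) → 0ℚ ℚ.≤ z ℚ./ 1 →
  (ρ : Vector ℝ n) → IsSpectrum A ρ →
  energy ρ ≤ fromℤ (+ n) * √ (n ℕ.∸ 1) * fromℤ z
hollow-energy-≤ {n} 2≤n A B z A≡-B B≡0 ∣B∣≤D 0≤D ρ spec ε 0<ε =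
  let N₁ , errors≤ = errors δ 0<δ
      N₂ , 1/≤     = archimedean η′ 0<η′
  in N₁ ℕ.⊔ N₂ , λ m h → bound m (errors≤ m (ℕ.m⊔n≤o⇒m≤o N₁ N₂ h)) (1/≤ m (ℕ.m⊔n≤o⇒n≤o N₁ N₂ h))
  where
  N D η : ℚ
  N = fromℕ n
  D = z ℚ./ 1
  -- Half of ε for the coefficients, half for the rounding of the square root.
  η = ½ ℚ.* ε
  0<η : 0ℚ ℚ.< η
  0<η = ½-pos 0<ε
  0<N : 0ℚ ℚ.< N
  0<N = ℚ.<-≤-trans (ℚ.positive⁻¹ 1ℚ) (fromℕ-mono (ℕ.≤-trans (ℕ.s≤s ℕ.z≤n) 2≤n))
  0≤N : 0ℚ ℚ.≤ N
  0≤N = ℚ.<⇒≤ 0<N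
  0≤ND : 0ℚ ℚ.≤ N ℚ.* D
  0≤ND = 0≤p*q 0≤N 0≤D
  0<η² : 0ℚ ℚ.< η ℚ.* η
  0<η² = ℚ.positive⁻¹ _ {{ℚ.pos*pos⇒pos η {{ℚ.positive 0<η}} η {{ℚ.positive 0<η}}}}
  δ-spec : ∃[ δ ] (0ℚ ℚ.< δ × δ ℚ.* N ≡ η ℚ.* η)
  δ-spec = quotient (η ℚ.* η) N 0<η² 0<N
  δ = proj₁ δ-spec
  0<δ = proj₁ (proj₂ δ-spec)
  -- The summand 1 keeps the divisor positive, as only N D ≥ 0 is at hand.
  η′-spec : ∃[ δ ] (0ℚ ℚ.< δ × δ ℚ.* (1ℚ ℚ.+ N ℚ.* D) ≡ η)
  η′-spec = quotient η (1ℚ ℚ.+ N ℚ.* D) 0<η (ℚ.+-mono-<-≤ (ℚ.positive⁻¹ 1ℚ) 0≤ND)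
  η′ = proj₁ η′-spec
  0<η′ = proj₁ (proj₂ η′-spec)

  r : ℕ → Vector ℚ n
  r m i = seq (ρ i) m
  e : ℕ → ℕ → ℚ
  e i m = detCoeff (Q.scalar 1ℚ) B i ℚ.- rootCoeff (r m) i
  -- Exactly the difference between ∑ rᵢ² and -2 times the third coefficient of the determinant: as
  -- the second coefficient is zero, `e 1 m` is minus the second coefficient of the root polynomial.
  error : ℕ → ℚ
  error m = e 1 m ℚ.* e 1 m ℚ.+ (e 2 m ℚ.+ e 2 m)
  errors : Vanishes error
  errors = vanishes-+ (vanishes-* v₁ v₁) (vanishes-+ v₂ v₂)
    where
    v₁ = spectrum-coefficients A ρ B A≡-B spec 1 (ℕ.≤-trans (ℕ.s≤s ℕ.z≤n) 2≤n)
    v₂ = spectrum-coefficients A ρ B A≡-B spec 2 2≤n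

  open ℚ.≤-Reasoning

  sum-squares≤ : ∀ m → ℚ.∣ error m ∣ ℚ.≤ δ →
    sum (λ i → r m i ℚ.* r m i) ℚ.≤ (N ℚ.* (N ℚ.- 1ℚ)) ℚ.* (D ℚ.* D) ℚ.+ δ
  sum-squares≤ m error≤ = begin
    sum (λ i → r m i ℚ.* r m i)
      ≡⟨ newton (r m) ⟨
    E₁ ℚ.* E₁ ℚ.- (E₂ ℚ.+ E₂)
      ≡⟨ solve 3 (λ e d f → e :* e :- (f :+ f) := :- (d :+ d)
                    :+ ((con 0ℚ :- e) :* (con 0ℚ :- e) :+ ((d :- f) :+ (d :- f))))
           refl E₁ D₂ E₂ ⟩
    ℚ.- (D₂ ℚ.+ D₂) ℚ.+ ((0ℚ ℚ.- E₁) ℚ.* (0ℚ ℚ.- E₁) ℚ.+ (e 2 m ℚ.+ e 2 m))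
      ≡⟨ cong (λ d → ℚ.- (D₂ ℚ.+ D₂) ℚ.+ ((d ℚ.- E₁) ℚ.* (d ℚ.- E₁) ℚ.+ (e 2 m ℚ.+ e 2 m)))
           (second-hollow (Q.scalar 1ℚ) B (λ _ _ → refl) B≡0) ⟨
    ℚ.- (D₂ ℚ.+ D₂) ℚ.+ error m
      ≤⟨ ℚ.+-mono-≤ (third-hollow (Q.scalar 1ℚ) B D (λ _ _ → refl) B≡0 ∣B∣≤D)
                    (ℚ.≤-trans (p≤∣p∣ (error m)) error≤) ⟩
    (N ℚ.* (N ℚ.- 1ℚ)) ℚ.* (D ℚ.* D) ℚ.+ δ ∎
    where
    E₁ = rootCoeff (r m) 1
    E₂ = rootCoeff (r m) 2
    D₂ = detCoeff (Q.scalar 1ℚ) B 2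

  NDh≤η : ∀ m → (+ 1) ℚ./ suc m ℚ.≤ η′ → (N ℚ.* D) ℚ.* ((+ 1) ℚ./ suc m) ℚ.≤ η
  NDh≤η m h≤ = begin
    (N ℚ.* D) ℚ.* ((+ 1) ℚ./ suc m)
      ≤⟨ ℚ.*-monoˡ-≤-nonNeg (N ℚ.* D) {{ℚ.nonNegative 0≤ND}} h≤ ⟩
    (N ℚ.* D) ℚ.* η′
      ≤⟨ p≤p+q _ (ℚ.<⇒≤ 0<η′) ⟩
    (N ℚ.* D) ℚ.* η′ ℚ.+ η′
      ≡⟨ solve 2 (λ a x → a :* x :+ x := x :* (con 1ℚ :+ a)) refl (N ℚ.* D) η′ ⟩
    η′ ℚ.* (1ℚ ℚ.+ N ℚ.* D)
      ≡⟨ proj₂ (proj₂ η′-spec) ⟩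
    η ∎

  bound : ∀ m → ℚ.∣ error m ∣ ℚ.≤ δ → (+ 1) ℚ./ suc m ℚ.≤ η′ →
    seq (energy ρ) m ℚ.≤ (N ℚ.* √-seq (n ℕ.∸ 1) m) ℚ.* D ℚ.+ ε
  bound m error≤ h≤ = begin
    seq (energy ρ) m
      ≡⟨ ∑-homo (term-hom m) (λ i → ∣ ρ i ∣) ⟩
    sum (λ i → ℚ.∣ r m i ∣)
      ≤⟨ absorb-errors 0≤N 0≤D
           (ℚ.nonNegative⁻¹ _ {{ℚ.normalize-nonNeg (isqrt ((n ℕ.∸ 1) ℕ.* (suc m ℕ.* suc m))) (suc m)}})
           (ℚ.nonNegative⁻¹ _ {{ℚ.normalize-nonNeg 1 (suc m)}}) (ℚ.<⇒≤ 0<η)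
           (ℚ.≤-trans (cauchy-schwarz (λ i → ℚ.∣ r m i ∣))
             (ℚ.≤-reflexive (cong (N ℚ.*_) (sum-cong-≗ λ i → ∣p∣*∣p∣≡p*p (r m i)))))
           (sum-squares≤ m error≤) (proj₂ (proj₂ δ-spec))
           (ℚ.≤-trans (ℚ.≤-reflexive (fromℕ-pred (ℕ.≤-trans (ℕ.s≤s ℕ.z≤n) 2≤n)))
             (√-seq-upper (n ℕ.∸ 1) m))
           (NDh≤η m h≤) ⟩
    (N ℚ.* √-seq (n ℕ.∸ 1) m) ℚ.* D ℚ.+ (η ℚ.+ η)
      ≡⟨ cong ((N ℚ.* √-seq (n ℕ.∸ 1) m) ℚ.* D ℚ.+_) (½+½ ε) ⟩
    (N ℚ.* √-seq (n ℕ.∸ 1) m) ℚ.* D ℚ.+ ε ∎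

-- Size of the Seidel entries

-- The hypothesis k ≤ n enters here. It gives 2C(n-2, k-2) - 1 ≥ 1, so that the bound also covers
-- pairs of codegree 0, whose Seidel entry is 1.
1≤nCk : ∀ {n k} → k ℕ.≤ n → 1 ℕ.≤ n C k
1≤nCk {n}     {zero}  _           = ℕ.≤-reflexive (sym (nC0≡1 n))
1≤nCk {suc n} {suc k} (ℕ.s≤s k≤n) = ℕ.≤-trans (1≤nCk k≤n)
  (subst (n C k ℕ.≤_) (nCk+nC[k+1]≡[n+1]C[k+1] n k) (ℕ.m≤m+n (n C k) (n C suc k)))

1≤2*m-1 : ∀ {m} → 1 ℕ.≤ m → 1ℚ ℚ.≤ (+ (2 ℕ.* m) ℤ.- + 1) ℚ./ 1
1≤2*m-1 {m} 1≤m = subst (1ℚ ℚ.≤_) (sym (/1-minus (2 ℕ.* m) 1))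
  (ℚ.+-monoˡ-≤ (ℚ.- 1ℚ) (fromℕ-mono {2} {2 ℕ.* m} (ℕ.*-monoʳ-≤ 2 1≤m)))

∣1-2c∣≤ : ∀ {c m} → c ℕ.≤ m → 1 ℕ.≤ m →
  ℚ.∣ (+ 1 ℤ.- + (2 ℕ.* c)) ℚ./ 1 ∣ ℚ.≤ (+ (2 ℕ.* m) ℤ.- + 1) ℚ./ 1
∣1-2c∣≤ {c} {m} c≤m 1≤m = ∣p∣≤ upper lower
  where
  open ℚ.≤-Reasoning
  x = fromℕ (2 ℕ.* c)
  y = fromℕ (2 ℕ.* m)
  upper : (+ 1 ℤ.- + (2 ℕ.* c)) ℚ./ 1 ℚ.≤ (+ (2 ℕ.* m) ℤ.- + 1) ℚ./ 1
  upper = begin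
    (+ 1 ℤ.- + (2 ℕ.* c)) ℚ./ 1   ≡⟨ /1-minus 1 (2 ℕ.* c) ⟩
    1ℚ ℚ.- x                      ≤⟨ p≤p+q (1ℚ ℚ.- x) (0≤fromℕ (2 ℕ.* c)) ⟩
    (1ℚ ℚ.- x) ℚ.+ x              ≡⟨ solve 1 (λ x → (con 1ℚ :- x) :+ x := con 1ℚ) refl x ⟩
    1ℚ                            ≤⟨ 1≤2*m-1 1≤m ⟩
    (+ (2 ℕ.* m) ℤ.- + 1) ℚ./ 1   ∎
  lower : ℚ.- ((+ 1 ℤ.- + (2 ℕ.* c)) ℚ./ 1) ℚ.≤ (+ (2 ℕ.* m) ℤ.- + 1) ℚ./ 1
  lower = begin
    ℚ.- ((+ 1 ℤ.- + (2 ℕ.* c)) ℚ./ 1)   ≡⟨ cong ℚ.-_ (/1-minus 1 (2 ℕ.* c)) ⟩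
    ℚ.- (1ℚ ℚ.- x)                ≡⟨ solve 1 (λ x → :- (con 1ℚ :- x) := x :- con 1ℚ) refl x ⟩
    x ℚ.- 1ℚ                      ≤⟨ ℚ.+-monoˡ-≤ (ℚ.- 1ℚ) (fromℕ-mono (ℕ.*-monoʳ-≤ 2 c≤m)) ⟩
    y ℚ.- 1ℚ                      ≡⟨ /1-minus (2 ℕ.* m) 1 ⟨
    (+ (2 ℕ.* m) ℤ.- + 1) ℚ./ 1   ∎

seidel-constant : ∀ {n} (ℋ : Hypergraph n) i j m →
  seq (seidel ℋ i j) m ≡ seq (seidel ℋ i j) 0
seidel-constant ℋ i j m with i Fin.≟ j
... | yes _ = refl
... | no _  = refl

seidel-hollow : ∀ {n} (ℋ : Hypergraph n) i → seq (seidel ℋ i i) 0 ≡ 0ℚ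
seidel-hollow ℋ i with i Fin.≟ i
... | yes _  = refl
... | no i≢i = contradiction refl i≢i

seidel-bounded : ∀ {n} (ℋ : Hypergraph n) m → 1 ℕ.≤ m →
  (∀ i j → i ≢ j → codegree ℋ i j ℕ.≤ m) → ∀ i j →
  ℚ.∣ seq (seidel ℋ i j) 0 ∣ ℚ.≤ (+ (2 ℕ.* m) ℤ.- + 1) ℚ./ 1
seidel-bounded ℋ m 1≤m c≤m i j with i Fin.≟ j
... | yes _  = ℚ.≤-trans (ℚ.<⇒≤ (ℚ.positive⁻¹ 1ℚ)) (1≤2*m-1 1≤m)
... | no i≢j = ∣1-2c∣≤ (c≤m i j i≢j) 1≤m

theorem3p9 : ∀ (n k : ℕ) → 2 ℕ.< n → 2 ℕ.≤ k → k ℕ.≤ n →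
    (ℋ : Hypergraph n) → IsUniform k ℋ →
    (ρ : Vector ℝ n) → IsSpectrum (seidel ℋ) ρ →
    energy ρ ≤ fromℤ (+ n) * √ (n ℕ.∸ 1) * fromℤ (+ (2 ℕ.* ((n ℕ.∸ 2) C (k ℕ.∸ 2))) ℤ.- + 1)
theorem3p9 (suc (suc n)) (suc (suc k)) 2<n _ (ℕ.s≤s (ℕ.s≤s k≤n)) ℋ uniform =
  -- B is -S, because the characteristic matrix xI - S is expanded as xI + B; the sign is immaterial
  -- for the bound on the entries.
  hollow-energy-≤ (ℕ.<⇒≤ 2<n) (seidel ℋ) (λ i j → ℚ.- seq (seidel ℋ i j) 0)
    (+ (2 ℕ.* (n C k)) ℤ.- + 1)
    (λ i j m → trans (seidel-constant ℋ i j m)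
      (solve 1 (λ a → a := :- (:- a)) refl (seq (seidel ℋ i j) 0)))
    (λ i → cong ℚ.-_ (seidel-hollow ℋ i))
    (λ i j → subst (ℚ._≤ _) (sym (ℚ.∣-p∣≡∣p∣ (seq (seidel ℋ i j) 0)))
      (seidel-bounded ℋ (n C k) 1≤C (codegree-≤ ℋ uniform) i j))
    (ℚ.≤-trans (ℚ.<⇒≤ (ℚ.positive⁻¹ 1ℚ)) (1≤2*m-1 1≤C))
  where
  1≤C : 1 ℕ.≤ n C k
  1≤C = 1≤nCk k≤n
theorem3p9 (suc (suc n)) (suc zero) _ (ℕ.s≤s ()) _
theorem3p9 (suc (suc n)) zero _ () _
theorem3p9 (suc zero) _ (ℕ.s≤s ()) _ _
theorem3p9 zero _ () _ _
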